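{- Let $U$ be a universe. Let $LC_U: LW(U)\to Cs_{\mathbb N}(U)$ be the functor given on objects by $(T,L)\mapsto (T^{op},LC(L))$ and on morphisms by $G\mapsto G^{op}$, and let $CL_U: Cs_{\mathbb N}(U)\to LW(U)$ be the functor given on objects by $(CC,cs)\mapsto (CC^{op},CL(cs))$ and on morphisms by $G\mapsto G^{op}$. Then $LC_U$ and $CL_U$ are mutually inverse isomorphisms (not merely equivalences) between the category $LW(U)$ of Lawvere theories in $U$ and the category $Cs_{\mathbb N}(U)$ of l-bijective C-systems in $U$; that is, $LC_U$ followed by $CL_U$ equals the identity functor of $LW(U)$, and $CL_U$ followed by $LC_U$ equals the identity functor of $Cs_{\mathbb N}(U)$.
   Context: **Conventions.** Compositions are written in diagrammatic order: for $f:X\to Y$, $g:Y\to Z$, the composite is $f\circ g:X\to Z$. A category consists of a set of objects and a set of morphisms with domain, codomain, identity and composition functions; equality of objects, morphisms and functors is strict. $T^{op}$ has the same sets of objects and morphisms as $T$, with domain and codomain exchanged, so $(T^{op})^{op}=T$; $G^{op}:T_1^{op}\to T_2^{op}$ has the same object and morphism functions as $G:T_1\to T_2$. "Universe" is not made precise; it is sufficient to take $U$ to be a Grothendieck universe. A Lawvere theory or a C-system is "in $U$" if the sets it consists of are in $U$. **The category $F$.** For $m\in\mathbb N$ let $stn(m)=\{i\in\mathbb N\mid 0\le i<m\}$. $F$ is the category with set of objects $\mathbb N$ and with morphisms from $m$ to $n$ all functions $stn(m)\to stn(n)$, with the usual composition. Let $ii_1^{m,n}:stn(m)\to stn(m+n)$,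 $i\mapsto i$, and $ii_2^{m,n}:stn(n)\to stn(m+n)$, $i\mapsto m+i$. **Lawvere theories.** A Lawvere theory structure on a category $T$ is a functor $L:F\to T$ such that (1) $L$ is a bijection on the sets of objects, (2) $L(0)$ is an initial object of $T$, (3) for all $m,n\in\mathbb N$ the square with sides $L(0)\to L(n)$, $L(0)\to L(m)$ (the unique morphisms), $L(ii_2^{m,n}):L(n)\to L(m+n)$, $L(ii_1^{m,n}):L(m)\to L(m+n)$ is a push-out square. A Lawvere theory is a pair $(T,L)$. A morphism $(T_1,L_1)\to(T_2,L_2)$ is a functor $G:T_1\to T_2$ with $L_1\circ G=L_2$ (strict equality). $LW(U)$ is the category of Lawvere theories in $U$ and their morphisms. **C-systems.** A C-system structure on a category $CC$ is $cs=(l,pt,ft,p,q,s)$ where: $l:Ob(CC)\to\mathbb N$ is a function (length); $pt\in Ob(CC)$; $ft:Ob(CC)\to Ob(CC)$ is a function; $p$ assigns to each object $X$ a morphism $p_X:X\to ft(X)$; $q$ assigns to each $X$ with $l(X)>0$ and each $f:Y\to ft(X)$ a morphism $q(f,X)$ with codomain $X$, whose domain is denoted $f^*(X)$; such that: (1) $l^{ -1}(0)=\{pt\}$; (2) $l(ft(X))=l(X)-1$ if $l(X)>0$; (3) $ft(pt)=pt$; (4) $pt$ is a final object; (5) for $l(X)>0$ and $f:Y\to ft(X)$ one has $l(f^*(X))>0$, $ft(f^*(X))=Y$ and $q(f,X)\circ p_X=p_{f^*(X)}\circ f$; (6) for $l(X)>0$, $(Id_{ft(X)})^*(X)=X$ and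 $q(Id_{ft(X)},X)=Id_X$; (7) for $l(X)>0$, $g:Z\to Y$, $f:Y\to ft(X)$, $(g\circ f)^*(X)=g^*(f^*(X))$ and $q(g\circ f,X)=q(g,f^*(X))\circ q(f,X)$; and $s$ assigns to each $f:Y\to X$ with $l(X)>0$ a morphism $s_f:Y\to (f\circ p_X)^*(X)$ such that (8) $s_f\circ p_{(f\circ p_X)^*(X)}=Id_Y$; (9) $s_f\circ q(f\circ p_X,X)=f$; (10) if $X=g^*(W)$ for some $W$ with $l(W)>0$ and $g:ft(X)\to ft(W)$, then $s_f=s_{f\circ q(g,W)}$. It is known that, given data $(l,pt,ft,p,q)$ satisfying (1)–(7), an operation $s$ satisfying (8)–(10) exists if and only if all squares in (5) are pull-back squares, and that $s$ is then unique. A homomorphism of C-systems $(CC_1,cs_1)\to(CC_2,cs_2)$ is a functor $H:CC_1\to CC_2$ with $l_2(H(X))=l_1(X)$, $H(pt_1)=pt_2$, $H(ft(X))=ft(H(X))$, $H(p_X)=p_{H(X)}$, $H(q(f,X))=q(H(f),H(X))$ and $H(s_f)=s_{H(f)}$ whenever defined. A C-system is l-bijective if $l:Ob(CC)\to\mathbb N$ is a bijection. $Cs_{\mathbb N}(U)$ is the category of l-bijective C-systems in $U$ and all homomorphisms of C-systems between them. **The construction $LC$.** Given a Lawvere theory structure $L$ on $T$, $LC(L)=(l,pt,ft,p,q,s)$ is the following l-bijective C-system structure on $CC=T^{op}$ (morphisms $L(g)$ are regarded as morphisms of $T^{op}$): $l=L^{ -1}$ on objects; $pt=L(0)$; $ft(pt)=pt$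 and $ft(X)=L(l(X)-1)$ if $l(X)>0$; $p_{pt}=Id_{pt}$ and $p_X=L(ii_1^{l(X)-1,1}):X\to ft(X)$ if $l(X)>0$; for $l(X)>0$ and $f:Y\to ft(X)$, $f^*(X)=L(l(Y)+1)$ and $q(f,X):f^*(X)\to X$ is the unique morphism of $T^{op}$ with $q(f,X)\circ p_X=p_{f^*(X)}\circ f$ and $q(f,X)\circ L(ii_2^{l(X)-1,1})=L(ii_2^{l(Y),1})$; $s$ is the unique operation completing this to a C-system structure. **The construction $CL$.** Given an l-bijective C-system structure $cs=(l,pt,ft,p,q,s)$ on $CC$, write $\pi_Y$ for the unique morphism $Y\to pt=l^{ -1}(0)$. Define morphisms $\pi^n_i:l^{ -1}(n)\to l^{ -1}(1)$ for $0\le i<n$ by: $\pi^1_0=Id_{l^{ -1}(1)}$; for $n\ge 1$, $\pi^{n+1}_i=p_{l^{ -1}(n+1)}\circ\pi^n_i$ if $i<n$, and $\pi^{n+1}_n=q(\pi_{l^{ -1}(n)},l^{ -1}(1))$. For $f:stn(m)\to stn(n)$ define $L_f:l^{ -1}(n)\to l^{ -1}(m)$ in $CC$ by induction on $m$: for $m=0$, $L_f=\pi_{l^{ -1}(n)}$; for $m=1$, $L_f=\pi^n_{f(0)}$; for $f:stn(m+1)\to stn(n)$ with $m\ge1$, $L_f$ is the unique morphism with $L_f\circ p_{l^{ -1}(m+1)}=L_{ii_1^{m,1}\circ f}$ and $L_f\circ q(\pi_{l^{ -1}(m)},l^{ -1}(1))=L_{ii_2^{m,1}\circ f}$. Then $CL(cs):F\to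 CC^{op}$ is the Lawvere theory structure on $CC^{op}$ given on objects by $n\mapsto l^{ -1}(n)$ and on morphisms by $f\mapsto L_f$. -}

module Defs where

open import Axiom.Extensionality.Propositional using (Extensionality; implicit-extensionality)
open import Axiom.UniquenessOfIdentityProofs.WithK using (uip)
open import Data.Fin using (Fin; zero; suc; fromℕ; inject₁; toℕ; splitAt; _↑ˡ_; _↑ʳ_)
open import Data.Fin.Properties using (toℕ-injective; toℕ-inject₁; toℕ-fromℕ; toℕ-↑ˡ; toℕ-↑ʳ; splitAt-↑ˡ; splitAt-↑ʳ; splitAt⁻¹-↑ˡ; splitAt⁻¹-↑ʳ)
open import Data.Fin.Relation.Unary.Top using (View; view; ‵fromℕ; ‵inj₁; view-fromℕ; view-inject₁)
open import Data.Nat using (ℕ; zero; suc; pred; _+_; _<_; z<s)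
open import Data.Nat.Properties using (+-comm; +-identityʳ)
open import Data.Product using (Σ-syntax; ∃!; _×_; _,_; proj₁; proj₂)
open import Data.Sum using (inj₁; inj₂; [_,_])
open import Function using (_∘_; const; Bijective)
open import Level using (Level; _⊔_; Setω) renaming (suc to lsuc)
open import Relation.Binary.PropositionalEquality using (_≡_; refl; sym; trans; cong; subst)

private
  variable
    o h o' h' o'' h'' : Level

-- Function extensionality, which the functions of set theory satisfy.  It is
-- what makes strict equality of functors, and of structures built from
-- functions, the intended one.
FunExt : Setω
FunExt = ∀ {a b} → Extensionality a b

-- Categories have strict (propositional) equality of objects and morphisms, and
-- composition is in diagrammatic order.  The field sym-assoc is redundant; it
-- makes op (op C) definitionally equal to C.
record Category o h : Set (lsuc (o ⊔ h)) where
  infixl 9 _⨾_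
  infixl 10 _▹_
  field
    Ob        : Set o
    Hom       : Ob → Ob → Set h
    id        : ∀ {X} → Hom X X
    _⨾_       : ∀ {X Y Z} → Hom X Y → Hom Y Z → Hom X Z
    identityˡ : ∀ {X Y} (f : Hom X Y) → id ⨾ f ≡ f
    identityʳ : ∀ {X Y} (f : Hom X Y) → f ⨾ id ≡ f
    assoc     : ∀ {W X Y Z} (f : Hom W X) (g : Hom X Y) (k : Hom Y Z) →
                (f ⨾ g) ⨾ k ≡ f ⨾ (g ⨾ k)
    sym-assoc : ∀ {W X Y Z} (f : Hom W X) (g : Hom X Y) (k : Hom Y Z) →
                f ⨾ (g ⨾ k) ≡ (f ⨾ g) ⨾ k

  -- f ▹ e is f itself, with its codomain Y written as Y'.
  _▹_ : ∀ {X Y Y'} → Hom X Y → Y ≡ Y' → Hom X Y'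
  f ▹ e = subst (Hom _) e f

  _◃_ : ∀ {X X' Y} → X ≡ X' → Hom X Y → Hom X' Y
  e ◃ f = subst (λ W → Hom W _) e f

-- Strict equality in the set of all morphisms of C: equality of domains, of
-- codomains and of the morphisms themselves.
data HomEq (C : Category o h) {X Y} (f : Category.Hom C X Y) :
           ∀ {X' Y'} → Category.Hom C X' Y' → Set (o ⊔ h) where
  refl : HomEq C f f

infix 4 HomEq
syntax HomEq C f g = C [ f ≋ g ]

op : Category o h → Category o h
op C = record
  { Ob        = Ob
  ; Hom       = λ X Y → Hom Y X
  ; id        = id
  ; _⨾_       = λ f g → g ⨾ f
  ; identityˡ = identityʳ
  ; identityʳ = identityˡ
  ; assoc     = λ f g k → sym-assoc k g f
  ; sym-assoc = λ f g k → assoc k g f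
  }
  where open Category C

record Functor (C : Category o h) (D : Category o' h') : Set (o ⊔ h ⊔ o' ⊔ h') where
  private
    module C = Category C
    module D = Category D
  field
    obj    : C.Ob → D.Ob
    hom    : ∀ {X Y} → C.Hom X Y → D.Hom (obj X) (obj Y)
    resp-id : ∀ {X} → hom (C.id {X}) ≡ D.id
    resp-⨾  : ∀ {X Y Z} (f : C.Hom X Y) (g : C.Hom Y Z) → hom (f C.⨾ g) ≡ hom f D.⨾ hom g

open Functor

opF : {C : Category o h} {D : Category o' h'} → Functor C D → Functor (op C) (op D)
opF G = record
  { obj = obj G ; hom = hom G ; resp-id = resp-id G ; resp-⨾ = λ f g → resp-⨾ G g f }

idF : {C : Category o h} → Functor C C
idF = record { obj = λ X → X ; hom = λ f → f ; resp-id = refl ; resp-⨾ = λ _ _ → refl }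

infixl 9 _⋙_
_⋙_ : {C : Category o h} {D : Category o' h'} {E : Category o'' h''} →
      Functor C D → Functor D E → Functor C E
G ⋙ H = record
  { obj     = λ X → obj H (obj G X)
  ; hom     = λ f → hom H (hom G f)
  ; resp-id = trans (cong (hom H) (resp-id G)) (resp-id H)
  ; resp-⨾  = λ f g → trans (cong (hom H) (resp-⨾ G f g)) (resp-⨾ H (hom G f) (hom G g))
  }

module _ (C : Category o h) where
  open Category C

  IsInitial : Ob → Set (o ⊔ h)
  IsInitial I = ∀ X → Σ[ ! ∈ Hom I X ] (∀ f → ! ≡ f)

  IsFinal : Ob → Set (o ⊔ h)
  IsFinal Z = ∀ X → Σ[ ! ∈ Hom X Z ] (∀ f → ! ≡ f)

  record IsPushout {A B₁ B₂ P} (f₁ : Hom A B₁) (f₂ : Hom A B₂)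
                   (i₁ : Hom B₁ P) (i₂ : Hom B₂ P) : Set (o ⊔ h) where
    field
      commute   : f₁ ⨾ i₁ ≡ f₂ ⨾ i₂
      universal : ∀ {E} (u₁ : Hom B₁ E) (u₂ : Hom B₂ E) → f₁ ⨾ u₁ ≡ f₂ ⨾ u₂ →
                  ∃! _≡_ (λ w → i₁ ⨾ w ≡ u₁ × i₂ ⨾ w ≡ u₂)

open IsPushout

F : Category _ _
F = record
  { Ob        = ℕ
  ; Hom       = λ m n → Fin m → Fin n
  ; id        = λ i → i
  ; _⨾_       = λ f g i → g (f i)
  ; identityˡ = λ _ → refl
  ; identityʳ = λ _ → refl
  ; assoc     = λ _ _ _ → refl
  ; sym-assoc = λ _ _ _ → refl
  }

record LawvereStr (T : Category o h) : Set (o ⊔ h) where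
  field
    L       : Functor F T
    obj-bij : Bijective _≡_ _≡_ (obj L)
    initial : IsInitial T (obj L 0)
    pushout : ∀ m n → IsPushout T (proj₁ (initial (obj L m))) (proj₁ (initial (obj L n)))
                                  (hom L (_↑ˡ n)) (hom L (m ↑ʳ_))

-- The universe U is Set ℓ.
record LawvereTheory ℓ : Set (lsuc ℓ) where
  constructor mkTheory
  field
    T   : Category ℓ ℓ
    str : LawvereStr T
  open LawvereStr str public

record LawvereMor {ℓ} (A B : LawvereTheory ℓ) : Set ℓ where
  constructor mkTheoryMor
  private
    module A = LawvereTheory A
    module B = LawvereTheory B
  field
    functor : Functor A.T B.T
    strict  : A.L ⋙ functor ≡ B.L

-- Proofs of 0 < l X are irrelevant, so the operations depend on X and f only.
record CSystemStr (CC : Category o h) : Set (o ⊔ h) where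
  open Category CC
  field
    l    : Ob → ℕ
    pt   : Ob
    ft   : Ob → Ob
    p    : ∀ X → Hom X (ft X)
    star : ∀ X .(X>0 : 0 < l X) {Y} (f : Hom Y (ft X)) → Ob
    q    : ∀ X .(X>0 : 0 < l X) {Y} (f : Hom Y (ft X)) → Hom (star X X>0 f) X

    l-pt     : l pt ≡ 0
    l-zero   : ∀ X → l X ≡ 0 → X ≡ pt
    l-ft     : ∀ X → .(0 < l X) → l (ft X) ≡ pred (l X)
    ft-pt    : ft pt ≡ pt
    pt-final : IsFinal CC pt

    star-l   : ∀ X .(X>0 : 0 < l X) {Y} (f : Hom Y (ft X)) → 0 < l (star X X>0 f)
    star-ft  : ∀ X .(X>0 : 0 < l X) {Y} (f : Hom Y (ft X)) → ft (star X X>0 f) ≡ Y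
    square   : ∀ X .(X>0 : 0 < l X) {Y} (f : Hom Y (ft X)) →
               q X X>0 f ⨾ p X ≡ (p (star X X>0 f) ▹ star-ft X X>0 f) ⨾ f

    star-id  : ∀ X .(X>0 : 0 < l X) → star X X>0 id ≡ X
    q-id     : ∀ X .(X>0 : 0 < l X) → CC [ q X X>0 id ≋ id {X} ]

    star-⨾   : ∀ X .(X>0 : 0 < l X) {Y Z} (g : Hom Z Y) (f : Hom Y (ft X)) →
               star X X>0 (g ⨾ f) ≡
               star (star X X>0 f) (star-l X X>0 f) (g ▹ sym (star-ft X X>0 f))
    q-⨾      : ∀ X .(X>0 : 0 < l X) {Y Z} (g : Hom Z Y) (f : Hom Y (ft X)) →
               CC [ q X X>0 (g ⨾ f) ≋
                    q (star X X>0 f) (star-l X X>0 f) (g ▹ sym (star-ft X X>0 f)) ⨾ q X X>0 f ]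

    s        : ∀ X .(X>0 : 0 < l X) {Y} (f : Hom Y X) → Hom Y (star X X>0 (f ⨾ p X))
    s-p      : ∀ X .(X>0 : 0 < l X) {Y} (f : Hom Y X) →
               CC [ s X X>0 f ⨾ p (star X X>0 (f ⨾ p X)) ≋ id {Y} ]
    s-q      : ∀ X .(X>0 : 0 < l X) {Y} (f : Hom Y X) →
               s X X>0 f ⨾ q X X>0 (f ⨾ p X) ≡ f
    -- X = g^*(W) has been substituted; V = ft(X) by star-ft.
    s-star   : ∀ W .(W>0 : 0 < l W) {V} (g : Hom V (ft W)) {Y} (f : Hom Y (star W W>0 g)) →
               CC [ s (star W W>0 g) (star-l W W>0 g) f ≋ s W W>0 (f ⨾ q W W>0 g) ]

record IsCSystemHom {C : Category o h} {D : Category o' h'}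
                    (cs₁ : CSystemStr C) (cs₂ : CSystemStr D) (H : Functor C D) :
                    Set (o ⊔ h ⊔ o' ⊔ h') where
  private
    module C = Category C
    module D = Category D
    module S₁ = CSystemStr cs₁
    module S₂ = CSystemStr cs₂
  field
    l-pres  : ∀ X → S₂.l (obj H X) ≡ S₁.l X

  pos-pres : ∀ X → 0 < S₁.l X → 0 < S₂.l (obj H X)
  pos-pres X X>0 = subst (0 <_) (sym (l-pres X)) X>0

  field
    pt-pres : obj H S₁.pt ≡ S₂.pt
    ft-pres : ∀ X → obj H (S₁.ft X) ≡ S₂.ft (obj H X)
    p-pres  : ∀ X → D [ hom H (S₁.p X) ≋ S₂.p (obj H X) ]
    q-pres  : ∀ X .(X>0 : 0 < S₁.l X) {Y} (f : C.Hom Y (S₁.ft X)) →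
              D [ hom H (S₁.q X X>0 f) ≋
                  S₂.q (obj H X) (pos-pres X X>0) (hom H f D.▹ ft-pres X) ]
    s-pres  : ∀ X .(X>0 : 0 < S₁.l X) {Y} (f : C.Hom Y X) →
              D [ hom H (S₁.s X X>0 f) ≋ S₂.s (obj H X) (pos-pres X X>0) (hom H f) ]

record LBijCSystem ℓ : Set (lsuc ℓ) where
  constructor mkSystem
  field
    CC    : Category ℓ ℓ
    cs    : CSystemStr CC
    l-bij : Bijective _≡_ _≡_ (CSystemStr.l cs)

record CSystemMor {ℓ} (A B : LBijCSystem ℓ) : Set ℓ where
  constructor mkSystemMor
  private
    module A = LBijCSystem A
    module B = LBijCSystem B
  field
    functor : Functor A.CC B.CC
    isHom   : IsCSystemHom A.cs B.cs functor

module HomEqReasoning (C : Category o h) where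
  open Category C

  ≋-sym : ∀ {X Y X' Y'} {f : Hom X Y} {g : Hom X' Y'} → C [ f ≋ g ] → C [ g ≋ f ]
  ≋-sym refl = refl

  infixr 5 _∙_
  _∙_ : ∀ {X Y X' Y' X'' Y''} {f : Hom X Y} {g : Hom X' Y'} {k : Hom X'' Y''} →
        C [ f ≋ g ] → C [ g ≋ k ] → C [ f ≋ k ]
  refl ∙ e = e

  ≡⇒≋ : ∀ {X Y} {f g : Hom X Y} → f ≡ g → C [ f ≋ g ]
  ≡⇒≋ refl = refl

  ≋⇒≡ : ∀ {X Y} {f g : Hom X Y} → C [ f ≋ g ] → f ≡ g
  ≋⇒≡ refl = refl

  ▹-≋ : ∀ {X Y Y'} (f : Hom X Y) (e : Y ≡ Y') → C [ f ▹ e ≋ f ]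
  ▹-≋ f refl = refl

  ◃-≋ : ∀ {X X' Y} (e : X ≡ X') (f : Hom X Y) → C [ e ◃ f ≋ f ]
  ◃-≋ refl f = refl

  ⨾-cong : ∀ {X Y Z X' Y' Z'} {f : Hom X Y} {f' : Hom X' Y'} {g : Hom Y Z} {g' : Hom Y' Z'} →
           C [ f ≋ f' ] → C [ g ≋ g' ] → C [ f ⨾ g ≋ f' ⨾ g' ]
  ⨾-cong refl refl = refl

  id-cong : ∀ {X Y} → X ≡ Y → C [ id {X} ≋ id {Y} ]
  id-cong refl = refl

  initial-unique : ∀ {I} → IsInitial C I → ∀ {X} (f g : Hom I X) → f ≡ g
  initial-unique i f g = trans (sym (proj₂ (i _) f)) (proj₂ (i _) g)

  final-unique : ∀ {Z} → IsFinal C Z → ∀ {X} (f g : Hom X Z) → f ≡ g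
  final-unique t f g = trans (sym (proj₂ (t _) f)) (proj₂ (t _) g)

op-≋ : (C : Category o h) → let open Category C in
       ∀ {X Y X' Y'} {f : Hom X Y} {g : Hom X' Y'} → C [ f ≋ g ] → op C [ f ≋ g ]
op-≋ C refl = refl

hom-cong : {C : Category o h} {D : Category o' h'} (H : Functor C D) →
           ∀ {X Y X' Y'} {f : Category.Hom C X Y} {g : Category.Hom C X' Y'} →
           C [ f ≋ g ] → D [ hom H f ≋ hom H g ]
hom-cong H refl = refl

obj-≡ : {C : Category o h} {D : Category o' h'} {G H : Functor C D} → G ≡ H →
        ∀ X → obj G X ≡ obj H X
obj-≡ refl X = refl

hom-≡ : {C : Category o h} {D : Category o' h'} {G H : Functor C D} → G ≡ H →
        ∀ {X Y} (f : Category.Hom C X Y) → D [ hom G f ≋ hom H f ]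
hom-≡ refl f = refl

module LCStr (ext : FunExt) {T : Category o h} (S : LawvereStr T) where
  open LawvereStr S
  open Category (op T)
  open HomEqReasoning (op T)

  private
    Lo : ℕ → Ob
    Lo = obj L

  -- In T^op, L(g) for g : stn(m) → stn(n) goes from L(n) to L(m).
  ⟪_⟫ : ∀ {m n} → (Fin m → Fin n) → Hom (Lo n) (Lo m)
  ⟪ g ⟫ = hom L g

  l : Ob → ℕ
  l X = proj₁ (proj₂ obj-bij X)

  Ll : ∀ X → Lo (l X) ≡ X
  Ll X = proj₂ (proj₂ obj-bij X) refl

  lL : ∀ n → l (Lo n) ≡ n
  lL n = proj₁ obj-bij (Ll (Lo n))

  pt : Ob
  pt = Lo 0

  -- As pred 0 = 0, this includes ft(pt) = pt.
  ft : Ob → Ob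
  ft X = Lo (pred (l X))

  -- inject₁ and const (fromℕ n) are ii₁^{n,1} and ii₂^{n,1}, with suc n for n + 1.
  pₙ : ∀ k → Hom (Lo k) (Lo (pred k))
  pₙ zero    = id
  pₙ (suc n) = ⟪ inject₁ ⟫

  vₙ : ∀ k → .(0 < k) → Hom (Lo k) (Lo 1)
  vₙ (suc n) _ = ⟪ const (fromℕ n) ⟫

  p : ∀ X → Hom X (ft X)
  p X = Ll X ◃ pₙ (l X)

  -- L(ii₂^{l(X)-1,1}) as a morphism from X.
  v : ∀ X → .(0 < l X) → Hom X (Lo 1)
  v X X>0 = Ll X ◃ vₙ (l X) X>0

  private
    pairing-at : ∀ n k → n + 1 ≡ k → (i₁ : Fin n → Fin k) (i₂ : Fin 1 → Fin k) →
                 (∀ i → toℕ (i₁ i) ≡ toℕ i) → (∀ i → toℕ (i₂ i) ≡ n + toℕ i) →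
                 ∀ {Y} (a : Hom Y (Lo n)) (b : Hom Y (Lo 1)) →
                 ∃! _≡_ (λ w → w ⨾ ⟪ i₁ ⟫ ≡ a × w ⨾ ⟪ i₂ ⟫ ≡ b)
    pairing-at n _ refl i₁ i₂ e₁ e₂ a b
      with refl ← ext {f = i₁} {g = _↑ˡ 1} (λ i → toℕ-injective (trans (e₁ i) (sym (toℕ-↑ˡ i 1))))
         | refl ← ext {f = i₂} {g = n ↑ʳ_} (λ i → toℕ-injective (trans (e₂ i) (sym (toℕ-↑ʳ n i))))
      = universal (pushout n 1) a b (final-unique initial _ _)

    pairingₙ : ∀ n {Y} (a : Hom Y (Lo n)) (b : Hom Y (Lo 1)) →
               ∃! _≡_ (λ w → w ⨾ ⟪ inject₁ ⟫ ≡ a × w ⨾ ⟪ const (fromℕ n) ⟫ ≡ b)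
    pairingₙ n = pairing-at n (suc n) (+-comm n 1) inject₁ (const (fromℕ n)) toℕ-inject₁
                   (λ { zero → trans (toℕ-fromℕ n) (sym (+-identityʳ n)) })

    pairing-to : ∀ k .(k>0 : 0 < k) X (e : Lo k ≡ X) {Y} (a : Hom Y (Lo (pred k))) (b : Hom Y (Lo 1)) →
                 ∃! _≡_ (λ w → w ⨾ (e ◃ pₙ k) ≡ a × w ⨾ (e ◃ vₙ k k>0) ≡ b)
    pairing-to (suc n) k>0 _ refl = pairingₙ n

  -- X is the product of ft(X) and L(1), with projections p_X and v_X.
  pairing : ∀ X .(X>0 : 0 < l X) {Y} (a : Hom Y (ft X)) (b : Hom Y (Lo 1)) →
            ∃! _≡_ (λ w → w ⨾ p X ≡ a × w ⨾ v X X>0 ≡ b)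
  pairing X X>0 = pairing-to (l X) X>0 X (Ll X)

  pair-unique : ∀ X .(X>0 : 0 < l X) {Y} {w w' : Hom Y X} →
                w ⨾ p X ≡ w' ⨾ p X → w ⨾ v X X>0 ≡ w' ⨾ v X X>0 → w ≡ w'
  pair-unique X X>0 {w = w} {w'} e₁ e₂ =
    trans (sym (u (e₁ , e₂))) (u (refl , refl))
    where u = proj₂ (proj₂ (pairing X X>0 (w' ⨾ p X) (w' ⨾ v X X>0)))

  star : ∀ X → .(0 < l X) → ∀ {Y} → Hom Y (ft X) → Ob
  star X X>0 {Y} f = Lo (suc (l Y))

  star-l : ∀ X .(X>0 : 0 < l X) {Y} (f : Hom Y (ft X)) → 0 < l (star X X>0 f)
  star-l X X>0 {Y} f = subst (0 <_) (sym (lL (suc (l Y)))) z<s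

  star-ft : ∀ X .(X>0 : 0 < l X) {Y} (f : Hom Y (ft X)) → ft (star X X>0 f) ≡ Y
  star-ft X X>0 {Y} f = trans (cong (Lo ∘ pred) (lL (suc (l Y)))) (Ll Y)

  -- The second equation is q(f,X) ∘ L(ii₂^{l(X)-1,1}) = L(ii₂^{l(Y),1}), because
  -- l(f^*(X)) - 1 = l(Y).
  q-exists : ∀ X .(X>0 : 0 < l X) {Y} (f : Hom Y (ft X)) →
             ∃! _≡_ (λ w → w ⨾ p X ≡ (p (star X X>0 f) ▹ star-ft X X>0 f) ⨾ f
                         × w ⨾ v X X>0 ≡ v (star X X>0 f) (star-l X X>0 f))
  q-exists X X>0 f = pairing X X>0 _ _

  q : ∀ X .(X>0 : 0 < l X) {Y} (f : Hom Y (ft X)) → Hom (star X X>0 f) X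
  q X X>0 f = proj₁ (q-exists X X>0 f)

  square : ∀ X .(X>0 : 0 < l X) {Y} (f : Hom Y (ft X)) →
           q X X>0 f ⨾ p X ≡ (p (star X X>0 f) ▹ star-ft X X>0 f) ⨾ f
  square X X>0 f = proj₁ (proj₁ (proj₂ (q-exists X X>0 f)))

  q-v : ∀ X .(X>0 : 0 < l X) {Y} (f : Hom Y (ft X)) →
        q X X>0 f ⨾ v X X>0 ≡ v (star X X>0 f) (star-l X X>0 f)
  q-v X X>0 f = proj₂ (proj₁ (proj₂ (q-exists X X>0 f)))

  s-exists : ∀ X .(X>0 : 0 < l X) {Y} (f : Hom Y X) → let X* = star X X>0 (f ⨾ p X) in
             ∃! _≡_ (λ (w : Hom Y X*) → w ⨾ p X* ≡ id ▹ sym (star-ft X X>0 (f ⨾ p X))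
                                      × w ⨾ v X* (star-l X X>0 (f ⨾ p X)) ≡ f ⨾ v X X>0)
  s-exists X X>0 f = pairing _ (star-l X X>0 (f ⨾ p X)) _ _

  s : ∀ X .(X>0 : 0 < l X) {Y} (f : Hom Y X) → Hom Y (star X X>0 (f ⨾ p X))
  s X X>0 f = proj₁ (s-exists X X>0 f)

  s-p : ∀ X .(X>0 : 0 < l X) {Y} (f : Hom Y X) →
        op T [ s X X>0 f ⨾ p (star X X>0 (f ⨾ p X)) ≋ id {Y} ]
  s-p X X>0 f = ≡⇒≋ (proj₁ (proj₁ (proj₂ (s-exists X X>0 f)))) ∙ ▹-≋ id _

  s-v : ∀ X .(X>0 : 0 < l X) {Y} (f : Hom Y X) →
        s X X>0 f ⨾ v (star X X>0 (f ⨾ p X)) (star-l X X>0 (f ⨾ p X)) ≡ f ⨾ v X X>0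
  s-v X X>0 f = proj₂ (proj₁ (proj₂ (s-exists X X>0 f)))

  private
    l-zero : ∀ X → l X ≡ 0 → X ≡ pt
    l-zero X e = trans (sym (Ll X)) (cong Lo e)

    suc-pred' : ∀ k → .(0 < k) → suc (pred k) ≡ k
    suc-pred' (suc k) _ = refl

    star-id : ∀ X .(X>0 : 0 < l X) → star X X>0 id ≡ X
    star-id X X>0 =
      trans (cong Lo (trans (cong suc (lL (pred (l X)))) (suc-pred' (l X) X>0))) (Ll X)

    id-from : ∀ X .(X>0 : 0 < l X) {Z} → Z ≡ X → .(Z>0 : 0 < l Z) (w : Hom Z X) →
              op T [ w ⨾ p X ≋ p Z ] → w ⨾ v X X>0 ≡ v Z Z>0 → op T [ w ≋ id {X} ]
    id-from X X>0 refl Z>0 w e₁ e₂ = ≡⇒≋ (pair-unique X X>0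
      (trans (≋⇒≡ e₁) (sym (identityˡ _))) (trans e₂ (sym (identityˡ _))))

    q-id : ∀ X .(X>0 : 0 < l X) → op T [ q X X>0 id ≋ id {X} ]
    q-id X X>0 = id-from X X>0 (star-id X X>0) (star-l X X>0 id) _
      (≡⇒≋ (trans (square X X>0 id) (identityʳ _)) ∙ ▹-≋ _ (star-ft X X>0 id)) (q-v X X>0 id)

    q-⨾ : ∀ X .(X>0 : 0 < l X) {Y Z} (g : Hom Z Y) (f : Hom Y (ft X)) →
          q X X>0 (g ⨾ f) ≡
          q (star X X>0 f) (star-l X X>0 f) (g ▹ sym (star-ft X X>0 f)) ⨾ q X X>0 f
    q-⨾ X X>0 {Y} {Z} g f = pair-unique X X>0
      (≋⇒≡ (≡⇒≋ (square X X>0 (g ⨾ f))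
          ∙ ≡⇒≋ (sym-assoc _ g f)
          ∙ ⨾-cong (⨾-cong refl (≋-sym (▹-≋ g (sym ef)))
                   ∙ ≡⇒≋ (sym (square X* X*>0 g'))
                   ∙ ⨾-cong refl (≋-sym (▹-≋ (p X*) ef))) refl
          ∙ ≡⇒≋ (assoc _ _ f)
          ∙ ⨾-cong refl (≡⇒≋ (sym (square X X>0 f)))
          ∙ ≡⇒≋ (sym-assoc _ _ _)))
      (trans (q-v X X>0 (g ⨾ f))
        (trans (sym (q-v X* X*>0 g'))
          (trans (cong (q X* X*>0 g' ⨾_) (sym (q-v X X>0 f)))
            (sym-assoc _ _ _))))
      where
      ef = star-ft X X>0 f
      X* = star X X>0 f
      X*>0 = star-l X X>0 f
      g' = g ▹ sym ef

    s-q : ∀ X .(X>0 : 0 < l X) {Y} (f : Hom Y X) → s X X>0 f ⨾ q X X>0 (f ⨾ p X) ≡ f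
    s-q X X>0 f = pair-unique X X>0
      (≋⇒≡ (≡⇒≋ (assoc _ _ _)
          ∙ ⨾-cong refl (≡⇒≋ (square X X>0 (f ⨾ p X)))
          ∙ ≡⇒≋ (sym-assoc _ _ _)
          ∙ ⨾-cong {g' = f ⨾ p X} (⨾-cong refl (▹-≋ _ (star-ft X X>0 (f ⨾ p X))) ∙ s-p X X>0 f) refl
          ∙ ≡⇒≋ (identityˡ _)))
      (trans (assoc _ _ _) (trans (cong (s X X>0 f ⨾_) (q-v X X>0 (f ⨾ p X))) (s-v X X>0 f)))

    s-star : ∀ W .(W>0 : 0 < l W) {V} (g : Hom V (ft W)) {Y} (f : Hom Y (star W W>0 g)) →
             s (star W W>0 g) (star-l W W>0 g) f ≡ s W W>0 (f ⨾ q W W>0 g)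
    s-star W W>0 g f = pair-unique _ (star-l W W>0 (f ⨾ q W W>0 g ⨾ p W))
      (≋⇒≡ (s-p W* W*>0 f ∙ ≋-sym (s-p W W>0 (f ⨾ q W W>0 g))))
      (trans (s-v W* W*>0 f)
        (trans (cong (f ⨾_) (sym (q-v W W>0 g)))
          (trans (sym-assoc _ _ _) (sym (s-v W W>0 (f ⨾ q W W>0 g))))))
      where
      W* = star W W>0 g
      W*>0 = star-l W W>0 g

  -- s is determined by the other data, so the choice made above is immaterial.
  LC : CSystemStr (op T)
  LC = record
    { l = l ; pt = pt ; ft = ft ; p = p ; star = star ; q = q
    ; l-pt = lL 0 ; l-zero = l-zero
    ; l-ft = λ X _ → lL (pred (l X))
    ; ft-pt = cong (Lo ∘ pred) (lL 0)
    ; pt-final = initial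
    ; star-l = star-l ; star-ft = star-ft ; square = square
    ; star-id = star-id ; q-id = q-id
    ; star-⨾ = λ _ _ _ _ → refl ; q-⨾ = λ X X>0 g f → ≡⇒≋ (q-⨾ X X>0 g f)
    ; s = s ; s-p = s-p ; s-q = s-q
    ; s-star = λ W W>0 g f → ≡⇒≋ (s-star W W>0 g f)
    }

  LC-bij : Bijective _≡_ _≡_ l
  LC-bij = (λ {X} {Y} e → trans (sym (Ll X)) (trans (cong Lo e) (Ll Y)))
         , (λ n → Lo n , λ { refl → lL n })

module CSystemProperties {CC : Category o h} (cs : CSystemStr CC) where
  open Category CC
  open HomEqReasoning CC
  open CSystemStr cs

  q-cong : ∀ {X X'} .{X>0 : 0 < l X} .{X'>0 : 0 < l X'} {Y Y'}
           {f : Hom Y (ft X)} {f' : Hom Y' (ft X')} →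
           X ≡ X' → CC [ f ≋ f' ] → CC [ q X X>0 f ≋ q X' X'>0 f' ]
  q-cong refl refl = refl

  s-cong : ∀ {X X'} .{X>0 : 0 < l X} .{X'>0 : 0 < l X'} {Y Y'}
           {f : Hom Y X} {f' : Hom Y' X'} →
           X ≡ X' → CC [ f ≋ f' ] → CC [ s X X>0 f ≋ s X' X'>0 f' ]
  s-cong refl refl = refl

  p-cong : ∀ {X X'} → X ≡ X' → CC [ p X ≋ p X' ]
  p-cong refl = refl

  module _ X .(X>0 : 0 < l X) {Y} (f : Hom Y (ft X)) where
    private
      X* = star X X>0 f
      X*>0 = star-l X X>0 f
      ef = star-ft X X>0 f

    pull-unique : ∀ {Z} {w w' : Hom Z X*} →
                  w ⨾ p X* ≡ w' ⨾ p X* → w ⨾ q X X>0 f ≡ w' ⨾ q X X>0 f → w ≡ w'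
    pull-unique {w = w} {w'} e₁ e₂ = ≋⇒≡
      (≡⇒≋ (sym (s-q X* X*>0 w))
      ∙ ⨾-cong (s-star X X>0 f w ∙ s-cong refl (≡⇒≋ e₂) ∙ ≋-sym (s-star X X>0 f w'))
               (q-cong refl (≡⇒≋ e₁))
      ∙ ≡⇒≋ (s-q X* X*>0 w'))

    pull-exists : ∀ {Z} (a : Hom Z Y) (b : Hom Z X) → a ⨾ f ≡ b ⨾ p X →
                  Σ[ w ∈ Hom Z X* ] (CC [ w ⨾ p X* ≋ a ] × w ⨾ q X X>0 f ≡ b)
    pull-exists {Z} a b e = w , w-p , w-q
      where
      a' = a ▹ sym ef
      q-eq : CC [ q X X>0 (b ⨾ p X) ≋ q X* X*>0 a' ⨾ q X X>0 f ]
      q-eq = q-cong refl (≡⇒≋ (sym e)) ∙ q-⨾ X X>0 a f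
      star-eq : star X X>0 (b ⨾ p X) ≡ star X* X*>0 a'
      star-eq = trans (cong (star X X>0) (sym e)) (star-⨾ X X>0 a f)
      s' : Hom Z (star X* X*>0 a')
      s' = s X X>0 b ▹ star-eq
      w = s' ⨾ q X* X*>0 a'
      w-q : w ⨾ q X X>0 f ≡ b
      w-q = ≋⇒≡ (≡⇒≋ (assoc _ _ _)
        ∙ ⨾-cong (▹-≋ _ star-eq) (≋-sym q-eq)
        ∙ ≡⇒≋ (s-q X X>0 b))
      w-p : CC [ w ⨾ p X* ≋ a ]
      w-p = ≡⇒≋ (assoc _ _ _)
        ∙ ⨾-cong {g' = (p (star X* X*>0 a') ▹ star-ft X* X*>0 a') ⨾ a'} refl (≡⇒≋ (square X* X*>0 a'))
        ∙ ≡⇒≋ (sym-assoc _ _ _)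
        ∙ ⨾-cong {g' = a} (⨾-cong (▹-≋ _ star-eq) (▹-≋ _ (star-ft X* X*>0 a') ∙ p-cong (sym star-eq))
                           ∙ s-p X X>0 b)
                          (▹-≋ a (sym ef))
        ∙ ≡⇒≋ (identityˡ a)

module CLStr (ext : FunExt) {CC : Category o h} (cs : CSystemStr CC)
             (l-bij : Bijective _≡_ _≡_ (CSystemStr.l cs)) where
  open Category CC
  open HomEqReasoning CC
  open CSystemStr cs
  open CSystemProperties cs

  l⁻¹ : ℕ → Ob
  l⁻¹ n = proj₁ (proj₂ l-bij n)

  l-l⁻¹ : ∀ n → l (l⁻¹ n) ≡ n
  l-l⁻¹ n = proj₂ (proj₂ l-bij n) refl

  l⁻¹-l : ∀ X → l⁻¹ (l X) ≡ X
  l⁻¹-l X = proj₁ l-bij (l-l⁻¹ (l X))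

  l⁻¹0 : pt ≡ l⁻¹ 0
  l⁻¹0 = proj₁ l-bij (trans l-pt (sym (l-l⁻¹ 0)))

  suc>0 : ∀ n → 0 < l (l⁻¹ (suc n))
  suc>0 n = subst (0 <_) (sym (l-l⁻¹ (suc n))) z<s

  ft-suc : ∀ n → ft (l⁻¹ (suc n)) ≡ l⁻¹ n
  ft-suc n = proj₁ l-bij (trans (l-ft _ (suc>0 n))
    (trans (cong pred (l-l⁻¹ (suc n))) (sym (l-l⁻¹ n))))

  -- π_Y, with its codomain pt written as l⁻¹(0).
  π! : ∀ Y → Hom Y (l⁻¹ 0)
  π! Y = proj₁ (pt-final Y) ▹ l⁻¹0

  private
    suc-eq : ∀ {k n} → .(0 < k) → pred k ≡ n → k ≡ suc n
    suc-eq {suc k} _ refl = refl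

  star-suc : ∀ n (f : Hom (l⁻¹ n) (ft (l⁻¹ 1))) → star (l⁻¹ 1) (suc>0 0) f ≡ l⁻¹ (suc n)
  star-suc n f = proj₁ l-bij (trans
    (suc-eq (star-l _ (suc>0 0) f)
      (trans (sym (l-ft _ (star-l _ (suc>0 0) f)))
        (trans (cong l (star-ft _ (suc>0 0) f)) (l-l⁻¹ n))))
    (sym (l-l⁻¹ (suc n))))

  -- p_{l⁻¹(n+1)} and q(π_{l⁻¹(n)}, l⁻¹(1)).
  pₙ : ∀ n → Hom (l⁻¹ (suc n)) (l⁻¹ n)
  pₙ n = p (l⁻¹ (suc n)) ▹ ft-suc n

  qₙ : ∀ n → Hom (l⁻¹ (suc n)) (l⁻¹ 1)
  qₙ n = star-suc n _ ◃ q (l⁻¹ 1) (suc>0 0) (π! (l⁻¹ n) ▹ sym (ft-suc 0))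

  -- View i tells whether i : Fin (suc n) is n (fromℕ) or is smaller (inj₁).
  π-view : ∀ n → (Fin n → Hom (l⁻¹ n) (l⁻¹ 1)) →
           ∀ {i : Fin (suc n)} → View i → Hom (l⁻¹ (suc n)) (l⁻¹ 1)
  π-view n πⁿ ‵fromℕ             = qₙ n
  π-view n πⁿ (‵inj₁ {i = i} _) = pₙ n ⨾ πⁿ i

  π : ∀ n → Fin n → Hom (l⁻¹ n) (l⁻¹ 1)
  π (suc zero)    i = id
  π (suc (suc n)) i = π-view (suc n) (π (suc n)) (view i)

  final₀ : IsFinal CC (l⁻¹ 0)
  final₀ X = π! X , λ f → ≋⇒≡ (▹-≋ _ l⁻¹0
    ∙ ≡⇒≋ (proj₂ (pt-final X) (f ▹ sym l⁻¹0)) ∙ ▹-≋ f (sym l⁻¹0))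

  private
    pairing-≋ : ∀ n {Y} (a : Hom Y (l⁻¹ n)) (b : Hom Y (l⁻¹ 1)) →
                ∀ {P} (f : Hom (l⁻¹ n) (ft (l⁻¹ 1))) (e : star (l⁻¹ 1) (suc>0 0) f ≡ P)
                (p' : Hom P (l⁻¹ n)) (q' : Hom P (l⁻¹ 1)) →
                CC [ p' ≋ p P ] → CC [ q' ≋ q (l⁻¹ 1) (suc>0 0) f ] →
                ∃! _≡_ (λ w → w ⨾ p' ≡ a × w ⨾ q' ≡ b)
    pairing-≋ n a b f refl p' q' e₁ e₂ with pull-exists (l⁻¹ 1) (suc>0 0) f a b
                                             (final-unique (subst (IsFinal CC) (sym (ft-suc 0)) final₀) _ _)
    ... | w , w-p , w-q =
      w , (≋⇒≡ (⨾-cong refl e₁ ∙ w-p) , ≋⇒≡ (⨾-cong refl e₂ ∙ ≡⇒≋ w-q))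
        , λ { {y} (y-p , y-q) → pull-unique (l⁻¹ 1) (suc>0 0) f
              (≋⇒≡ (w-p ∙ ≡⇒≋ (sym y-p) ∙ ⨾-cong refl e₁))
              (≋⇒≡ (≡⇒≋ w-q ∙ ≡⇒≋ (sym y-q) ∙ ⨾-cong refl e₂)) }

  -- l⁻¹(n+1) is the product of l⁻¹(n) and l⁻¹(1).
  pairing : ∀ n {Y} (a : Hom Y (l⁻¹ n)) (b : Hom Y (l⁻¹ 1)) →
            ∃! _≡_ (λ w → w ⨾ pₙ n ≡ a × w ⨾ qₙ n ≡ b)
  pairing n a b = pairing-≋ n a b (π! (l⁻¹ n) ▹ sym (ft-suc 0)) (star-suc n _) (pₙ n) (qₙ n)
                    (▹-≋ _ (ft-suc n)) (◃-≋ (star-suc n _) _)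

  -- ⟪ f ⟫ is L_f.  In the last clause it is the unique morphism with components
  -- L_{ii₁^{m+1,1} ∘ f} and L_{ii₂^{m+1,1} ∘ f}; the latter is π^n_{f(m+1)}.
  ⟪_⟫ : ∀ {m n} → (Fin m → Fin n) → Hom (l⁻¹ n) (l⁻¹ m)
  ⟪_⟫ {zero}        {n} f = π! (l⁻¹ n)
  ⟪_⟫ {suc zero}    {n} f = π n (f zero)
  ⟪_⟫ {suc (suc m)} {n} f = proj₁ (pairing (suc m) ⟪ f ∘ inject₁ ⟫ (π n (f (fromℕ (suc m)))))

  private
    pair-unique : ∀ n {Y} {w w' : Hom Y (l⁻¹ (suc n))} →
                  w ⨾ pₙ n ≡ w' ⨾ pₙ n → w ⨾ qₙ n ≡ w' ⨾ qₙ n → w ≡ w'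
    pair-unique n {w = w} {w'} e₁ e₂ = trans (sym (u (e₁ , e₂))) (u (refl , refl))
      where u = proj₂ (proj₂ (pairing n (w' ⨾ pₙ n) (w' ⨾ qₙ n)))

    π-fromℕ : ∀ n → π (suc (suc n)) (fromℕ (suc n)) ≡ qₙ (suc n)
    π-fromℕ n = cong (π-view (suc n) (π (suc n))) (view-fromℕ (suc n))

    π-inject₁ : ∀ n i → π (suc (suc n)) (inject₁ i) ≡ pₙ (suc n) ⨾ π (suc n) i
    π-inject₁ n i = cong (π-view (suc n) (π (suc n))) (view-inject₁ i)

  -- l⁻¹(m) is the m-th power of l⁻¹(1), with projections π^m_i.
  π-unique : ∀ m {Y} {w w' : Hom Y (l⁻¹ m)} → (∀ i → w ⨾ π m i ≡ w' ⨾ π m i) → w ≡ w'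
  π-unique zero          e = final-unique final₀ _ _
  π-unique (suc zero)    e = trans (sym (identityʳ _)) (trans (e zero) (identityʳ _))
  π-unique (suc (suc m)) {w = w} {w'} e = pair-unique (suc m)
    (π-unique (suc m) (λ i → trans (assoc _ _ _)
      (trans (cong (w ⨾_) (sym (π-inject₁ m i)))
      (trans (e (inject₁ i))
      (trans (cong (w' ⨾_) (π-inject₁ m i)) (sym-assoc _ _ _))))))
    (trans (cong (w ⨾_) (sym (π-fromℕ m)))
      (trans (e (fromℕ (suc m))) (cong (w' ⨾_) (π-fromℕ m))))

  tuple : ∀ m {Y} (g : Fin m → Hom Y (l⁻¹ 1)) → Σ[ w ∈ Hom Y (l⁻¹ m) ] (∀ i → w ⨾ π m i ≡ g i)
  tuple zero          g = π! _ , λ ()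
  tuple (suc zero)    g = g zero , λ { zero → identityʳ _ }
  tuple (suc (suc m)) g with tuple (suc m) (g ∘ inject₁)
  ... | w' , e' with pairing (suc m) w' (g (fromℕ (suc m)))
  ... | w , (e₁ , e₂) , _ = w , λ i → go (view i)
    where
    go : ∀ {i} → View i → w ⨾ π (suc (suc m)) i ≡ g i
    go ‵fromℕ            = trans (cong (w ⨾_) (π-fromℕ m)) e₂
    go (‵inj₁ {i = i} _) = trans (cong (w ⨾_) (π-inject₁ m i))
      (trans (sym-assoc _ _ _) (trans (cong (_⨾ π (suc m) i) e₁) (e' i)))

  ⟪⟫-π : ∀ m {n} (f : Fin m → Fin n) i → ⟪ f ⟫ ⨾ π m i ≡ π n (f i)
  ⟪⟫-π (suc zero)    {n} f zero = identityʳ _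
  ⟪⟫-π (suc (suc m)) {n} f i    = go (⟪⟫-π (suc m) (f ∘ inject₁)) (view i)
    where
    e = proj₁ (proj₂ (pairing (suc m) ⟪ f ∘ inject₁ ⟫ (π n (f (fromℕ (suc m))))))
    go : (∀ i → ⟪ f ∘ inject₁ ⟫ ⨾ π (suc m) i ≡ π n (f (inject₁ i))) →
         ∀ {i} → View i → ⟪ f ⟫ ⨾ π (suc (suc m)) i ≡ π n (f i)
    go _  ‵fromℕ            = trans (cong (⟪ f ⟫ ⨾_) (π-fromℕ m)) (proj₂ e)
    go ih (‵inj₁ {i = i} _) = trans (cong (⟪ f ⟫ ⨾_) (π-inject₁ m i))
      (trans (sym-assoc _ _ _) (trans (cong (_⨾ π (suc m) i) (proj₁ e)) (ih i)))

  CL-functor : Functor F (op CC)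
  CL-functor = record
    { obj     = l⁻¹
    ; hom     = ⟪_⟫
    ; resp-id = λ {n} → π-unique n (λ i → trans (⟪⟫-π n (λ i → i) i) (sym (identityˡ _)))
    ; resp-⨾  = λ {k} {m} {n} f g → π-unique k (λ i →
        trans (⟪⟫-π k (λ i → g (f i)) i)
        (sym (trans (assoc _ _ _)
        (trans (cong (⟪ g ⟫ ⨾_) (⟪⟫-π k f i)) (⟪⟫-π m g (f i))))))
    }

  private
    pushout : ∀ m n → IsPushout (op CC) (proj₁ (final₀ (l⁻¹ m))) (proj₁ (final₀ (l⁻¹ n)))
                                        ⟪ _↑ˡ n ⟫ ⟪ m ↑ʳ_ ⟫
    pushout m n = record
      { commute   = final-unique final₀ _ _
      ; universal = λ {Y} a b _ →
          let w , e = tuple (m + n) (λ i → [ (λ j → a ⨾ π m j) , (λ j → b ⨾ π n j) ] (splitAt m i))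
          in w
           , ( π-unique m (λ i → trans (assoc _ _ _) (trans (cong (w ⨾_) (⟪⟫-π m (_↑ˡ n) i))
                 (trans (e (i ↑ˡ n)) (cong [ _ , _ ] (splitAt-↑ˡ m i n)))))
             , π-unique n (λ i → trans (assoc _ _ _) (trans (cong (w ⨾_) (⟪⟫-π n (m ↑ʳ_) i))
                 (trans (e (m ↑ʳ i)) (cong [ _ , _ ] (splitAt-↑ʳ m n i))))))
           , λ {w'} (e₁ , e₂) → π-unique (m + n) (λ i →
               trans (e i) (split-case a b w' e₁ e₂ i (splitAt m i) refl))
      }
      where
      split-case : ∀ {Y} (a : Hom Y (l⁻¹ m)) (b : Hom Y (l⁻¹ n)) (w' : Hom Y (l⁻¹ (m + n))) →
                   w' ⨾ ⟪ _↑ˡ n ⟫ ≡ a → w' ⨾ ⟪ m ↑ʳ_ ⟫ ≡ b → ∀ i r → splitAt m i ≡ r →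
                   [ (λ j → a ⨾ π m j) , (λ j → b ⨾ π n j) ] r ≡ w' ⨾ π (m + n) i
      split-case a b w' refl refl i (inj₁ j) e
        with refl ← splitAt⁻¹-↑ˡ {m} {n} {i} {j} e =
        trans (assoc _ _ _) (cong (w' ⨾_) (⟪⟫-π m (_↑ˡ n) j))
      split-case a b w' refl refl i (inj₂ j) e
        with refl ← splitAt⁻¹-↑ʳ {m} {n} {i} {j} e =
        trans (assoc _ _ _) (cong (w' ⨾_) (⟪⟫-π n (m ↑ʳ_) j))

  CL : LawvereStr (op CC)
  CL = record
    { L       = CL-functor
    ; obj-bij = (λ {m} {n} e → trans (sym (l-l⁻¹ m)) (trans (cong l e) (l-l⁻¹ n)))
              , (λ X → l X , λ { refl → l⁻¹-l X })
    ; initial = final₀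
    ; pushout = pushout
    }

module Extensional (ext : FunExt) where

  private
    ext-implicit : ∀ {a b} {A : Set a} {B : A → Set b} {f g : {x : A} → B x} →
                   (∀ x → f {x} ≡ g {x}) → (λ {x} → f {x}) ≡ (λ {x} → g {x})
    ext-implicit e = implicit-extensionality ext (λ {x} → e x)

    record Irr {a} (A : Set a) : Set a where
      constructor irr
      field .get : A

    ext-irrelevant : ∀ {a b} {A : Set a} {B : .A → Set b} {f g : .(x : A) → B x} →
                     (.(x : A) → f x ≡ g x) → f ≡ g
    ext-irrelevant {B = B} {f} {g} e = cong (λ k .x → k (irr x))
      (ext {B = λ { (irr x) → B x }} {f = λ { (irr x) → f x }} {g = λ { (irr x) → g x }}
           λ { (irr x) → e x })

    HomEq-irrelevant : {C : Category o h} → let open Category C in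
                       ∀ {X Y X' Y'} {f : Hom X Y} {g : Hom X' Y'} (a b : C [ f ≋ g ]) → a ≡ b
    HomEq-irrelevant refl refl = refl

  Functor-≡ : {C : Category o h} {D : Category o' h'} {G H : Functor C D} →
              (∀ X → obj G X ≡ obj H X) →
              (∀ {X Y} (f : Category.Hom C X Y) → D [ hom G f ≋ hom H f ]) → G ≡ H
  Functor-≡ {C = C} {D} {record { obj = a ; hom = b ; resp-id = c ; resp-⨾ = d }}
                        {record { obj = a' ; hom = b' ; resp-id = c' ; resp-⨾ = d' }} eo eh
    with refl ← ext {f = a} {g = a'} eo
    with refl ← ext-implicit {f = λ {X} {Y} → b {X} {Y}} {g = λ {X} {Y} → b' {X} {Y}}
                  (λ X → ext-implicit (λ Y → ext (λ f → HomEqReasoning.≋⇒≡ D (eh f))))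
    with refl ← ext-implicit {f = λ {X} → c {X}} {g = λ {X} → c' {X}} (λ X → uip _ _)
    with refl ← ext-implicit {f = λ {X} {Y} {Z} → d {X} {Y} {Z}} {g = λ {X} {Y} {Z} → d' {X} {Y} {Z}}
                  (λ X → ext-implicit (λ Y → ext-implicit (λ Z → ext (λ f → ext (λ g → uip _ _)))))
    = refl

  IsCSystemHom-irrelevant :
    {C : Category o h} {D : Category o' h'} {cs₁ : CSystemStr C} {cs₂ : CSystemStr D}
    {H : Functor C D} (a b : IsCSystemHom cs₁ cs₂ H) → a ≡ b
  IsCSystemHom-irrelevant
    record { l-pres = a₁ ; pt-pres = a₂ ; ft-pres = a₃ ; p-pres = a₄ ; q-pres = a₅ ; s-pres = a₆ }
    record { l-pres = b₁ ; pt-pres = b₂ ; ft-pres = b₃ ; p-pres = b₄ ; q-pres = b₅ ; s-pres = b₆ }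
    with refl ← ext {f = a₁} {g = b₁} (λ _ → uip _ _)
    with refl ← uip a₂ b₂
    with refl ← ext {f = a₃} {g = b₃} (λ _ → uip _ _)
    with refl ← ext {f = a₄} {g = b₄} (λ _ → HomEq-irrelevant _ _)
    with refl ← ext {f = a₅} {g = b₅} (λ _ → ext-irrelevant (λ _ → ext-implicit (λ _ → ext (λ _ → HomEq-irrelevant _ _))))
    with refl ← ext {f = a₆} {g = b₆} (λ _ → ext-irrelevant (λ _ → ext-implicit (λ _ → ext (λ _ → HomEq-irrelevant _ _))))
    = refl

  LawvereMor-≡ : ∀ {ℓ} {A B : LawvereTheory ℓ} {G H : LawvereMor A B} →
                 LawvereMor.functor G ≡ LawvereMor.functor H → G ≡ H
  LawvereMor-≡ {G = mkTheoryMor G e} {mkTheoryMor .G e'} refl = cong (mkTheoryMor G) (uip e e')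

  CSystemMor-≡ : ∀ {ℓ} {A B : LBijCSystem ℓ} {G H : CSystemMor A B} →
                 CSystemMor.functor G ≡ CSystemMor.functor H → G ≡ H
  CSystemMor-≡ {G = mkSystemMor G e} {mkSystemMor .G e'} refl =
    cong (mkSystemMor G) (IsCSystemHom-irrelevant e e')

  private
    LawvereMor-⨾ : ∀ {ℓ} {A B C : LawvereTheory ℓ} → LawvereMor A B → LawvereMor B C → LawvereMor A C
    LawvereMor-⨾ {C = C} (mkTheoryMor G e) (mkTheoryMor H e') = mkTheoryMor (G ⋙ H)
      (Functor-≡ (λ n → trans (cong (obj H) (obj-≡ e n)) (obj-≡ e' n))
                 (λ f → hom-cong H (hom-≡ e f) ∙ hom-≡ e' f))
      where open HomEqReasoning (LawvereTheory.T C)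

    IsCSystemHom-id : {C : Category o h} {cs : CSystemStr C} → IsCSystemHom cs cs idF
    IsCSystemHom-id = record
      { l-pres = λ _ → refl ; pt-pres = refl ; ft-pres = λ _ → refl ; p-pres = λ _ → refl
      ; q-pres = λ _ _ _ → refl ; s-pres = λ _ _ _ → refl }

    IsCSystemHom-⨾ :
      {C : Category o h} {D : Category o' h'} {E : Category o'' h''}
      {cs₁ : CSystemStr C} {cs₂ : CSystemStr D} {cs₃ : CSystemStr E}
      {G : Functor C D} {H : Functor D E} →
      IsCSystemHom cs₁ cs₂ G → IsCSystemHom cs₂ cs₃ H → IsCSystemHom cs₁ cs₃ (G ⋙ H)
    IsCSystemHom-⨾ {E = E} {cs₃ = cs₃} {G = G} {H} a b = record
      { l-pres  = λ X → trans (b.l-pres _) (a.l-pres X)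
      ; pt-pres = trans (cong (obj H) a.pt-pres) b.pt-pres
      ; ft-pres = λ X → trans (cong (obj H) (a.ft-pres X)) (b.ft-pres _)
      ; p-pres  = λ X → hom-cong H (a.p-pres X) ∙ b.p-pres _
      ; q-pres  = λ X X>0 f →
          hom-cong H (a.q-pres X X>0 f) ∙ b.q-pres _ _ _
          ∙ q-cong refl (▹-≋ _ (b.ft-pres (obj G X)) ∙ hom-cong H (HomEqReasoning.▹-≋ _ _ (a.ft-pres X))
              ∙ ≋-sym (▹-≋ _ (trans (cong (obj H) (a.ft-pres X)) (b.ft-pres (obj G X)))))
      ; s-pres  = λ X X>0 f → hom-cong H (a.s-pres X X>0 f) ∙ b.s-pres _ _ _
      }
      where
      module a = IsCSystemHom a
      module b = IsCSystemHom b
      open HomEqReasoning E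
      open CSystemProperties cs₃

  LW : ∀ ℓ → Category (lsuc ℓ) ℓ
  LW ℓ = record
    { Ob        = LawvereTheory ℓ
    ; Hom       = LawvereMor
    ; id        = mkTheoryMor idF (Functor-≡ (λ _ → refl) (λ _ → refl))
    ; _⨾_       = LawvereMor-⨾
    ; identityˡ = λ _ → LawvereMor-≡ (Functor-≡ (λ _ → refl) (λ _ → refl))
    ; identityʳ = λ _ → LawvereMor-≡ (Functor-≡ (λ _ → refl) (λ _ → refl))
    ; assoc     = λ _ _ _ → LawvereMor-≡ (Functor-≡ (λ _ → refl) (λ _ → refl))
    ; sym-assoc = λ _ _ _ → LawvereMor-≡ (Functor-≡ (λ _ → refl) (λ _ → refl))
    }

  Csℕ : ∀ ℓ → Category (lsuc ℓ) ℓ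
  Csℕ ℓ = record
    { Ob        = LBijCSystem ℓ
    ; Hom       = CSystemMor
    ; id        = mkSystemMor idF IsCSystemHom-id
    ; _⨾_       = λ G H → mkSystemMor (CSystemMor.functor G ⋙ CSystemMor.functor H)
                                      (IsCSystemHom-⨾ (CSystemMor.isHom G) (CSystemMor.isHom H))
    ; identityˡ = λ _ → CSystemMor-≡ (Functor-≡ (λ _ → refl) (λ _ → refl))
    ; identityʳ = λ _ → CSystemMor-≡ (Functor-≡ (λ _ → refl) (λ _ → refl))
    ; assoc     = λ _ _ _ → CSystemMor-≡ (Functor-≡ (λ _ → refl) (λ _ → refl))
    ; sym-assoc = λ _ _ _ → CSystemMor-≡ (Functor-≡ (λ _ → refl) (λ _ → refl))
    }

  module LCMor {ℓ} {A B : LawvereTheory ℓ} (G : LawvereMor A B) where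
    private
      module TA = LawvereTheory A
      module TB = LawvereTheory B
      module A = LCStr ext TA.str
      module B = LCStr ext TB.str
      open LawvereMor G
      H : Functor (op TA.T) (op TB.T)
      H = opF functor
      open Category (op TB.T)
      open HomEqReasoning (op TB.T)
      open CSystemProperties B.LC

      obj-L : ∀ n → obj H (obj TA.L n) ≡ obj TB.L n
      obj-L = obj-≡ strict

      hom-L : ∀ {m n} (f : Fin m → Fin n) → op TB.T [ hom H A.⟪ f ⟫ ≋ B.⟪ f ⟫ ]
      hom-L f = op-≋ TB.T (hom-≡ strict f)

      l-pres : ∀ X → B.l (obj H X) ≡ A.l X
      l-pres X = trans (cong B.l (trans (cong (obj H) (sym (A.Ll X))) (obj-L (A.l X)))) (B.lL (A.l X))

      pos : ∀ X → 0 < A.l X → 0 < B.l (obj H X)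
      pos X = subst (0 <_) (sym (l-pres X))

      ft-pres : ∀ X → obj H (A.ft X) ≡ B.ft (obj H X)
      ft-pres X = trans (obj-L _) (cong (obj TB.L ∘ pred) (sym (l-pres X)))

      pₙ-pres : ∀ k → op TB.T [ hom H (A.pₙ k) ≋ B.pₙ k ]
      pₙ-pres zero    = ≡⇒≋ (resp-id H) ∙ id-cong (obj-L 0)
      pₙ-pres (suc n) = hom-L inject₁

      vₙ-pres : ∀ k .(k>0 : 0 < k) → op TB.T [ hom H (A.vₙ k k>0) ≋ B.vₙ k k>0 ]
      vₙ-pres (suc n) _ = hom-L (const (fromℕ n))

      pₙ-cong : ∀ {k k'} → k ≡ k' → op TB.T [ B.pₙ k ≋ B.pₙ k' ]
      pₙ-cong refl = refl

      vₙ-cong : ∀ {k k'} .{k>0 : 0 < k} .{k'>0 : 0 < k'} → k ≡ k' →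
                op TB.T [ B.vₙ k k>0 ≋ B.vₙ k' k'>0 ]
      vₙ-cong refl = refl

      v-cong : ∀ {X X'} .{X>0 : 0 < B.l X} .{X'>0 : 0 < B.l X'} → X ≡ X' →
               op TB.T [ B.v X X>0 ≋ B.v X' X'>0 ]
      v-cong refl = refl

      p-pres : ∀ X → op TB.T [ hom H (A.p X) ≋ B.p (obj H X) ]
      p-pres X = hom-cong H (HomEqReasoning.◃-≋ _ (A.Ll X) _) ∙ pₙ-pres (A.l X)
        ∙ pₙ-cong (sym (l-pres X)) ∙ ≋-sym (◃-≋ (B.Ll (obj H X)) _)

      v-pres : ∀ X .(X>0 : 0 < A.l X) → op TB.T [ hom H (A.v X X>0) ≋ B.v (obj H X) (pos X X>0) ]
      v-pres X X>0 = hom-cong H (HomEqReasoning.◃-≋ _ (A.Ll X) _) ∙ vₙ-pres (A.l X) X>0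
        ∙ vₙ-cong (sym (l-pres X)) ∙ ≋-sym (◃-≋ (B.Ll (obj H X)) _)

      star-pres : ∀ Y → obj H (obj TA.L (suc (A.l Y))) ≡ obj TB.L (suc (B.l (obj H Y)))
      star-pres Y = trans (obj-L _) (cong (obj TB.L ∘ suc) (sym (l-pres Y)))

      q-pres : ∀ X .(X>0 : 0 < A.l X) {Y} (f : Category.Hom (op TA.T) Y (A.ft X)) →
               op TB.T [ hom H (A.q X X>0 f) ≋ B.q (obj H X) (pos X X>0) (hom H f ▹ ft-pres X) ]
      q-pres X X>0 {Y} f = ≋-sym (◃-≋ (star-pres Y) _) ∙ ≡⇒≋ (B.pair-unique (obj H X) (pos X X>0)
        (≋⇒≡ (⨾-cong (◃-≋ (star-pres Y) _) (≋-sym (p-pres X))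
          ∙ ≡⇒≋ (trans (sym (resp-⨾ H _ _)) (trans (cong (hom H) (A.square X X>0 f)) (resp-⨾ H _ _)))
          ∙ ⨾-cong (hom-cong H (HomEqReasoning.▹-≋ _ _ (A.star-ft X X>0 f)) ∙ p-pres _
                    ∙ p-cong (star-pres Y) ∙ ≋-sym (▹-≋ _ (B.star-ft (obj H X) (pos X X>0) f')))
                   (≋-sym (▹-≋ (hom H f) (ft-pres X)))
          ∙ ≡⇒≋ (sym (B.square (obj H X) (pos X X>0) f'))))
        (≋⇒≡ (⨾-cong (◃-≋ (star-pres Y) _) (≋-sym (v-pres X X>0))
          ∙ ≡⇒≋ (trans (sym (resp-⨾ H _ _)) (cong (hom H) (A.q-v X X>0 f)))
          ∙ v-pres _ (A.star-l X X>0 f)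
          ∙ v-cong (star-pres Y)
          ∙ ≡⇒≋ (sym (B.q-v (obj H X) (pos X X>0) f')))))
        where f' = hom H f ▹ ft-pres X

      s-pres : ∀ X .(X>0 : 0 < A.l X) {Y} (f : Category.Hom (op TA.T) Y X) →
               op TB.T [ hom H (A.s X X>0 f) ≋ B.s (obj H X) (pos X X>0) (hom H f) ]
      s-pres X X>0 {Y} f = ≋-sym (▹-≋ _ (star-pres Y)) ∙ ≡⇒≋ (B.pair-unique _ (B.star-l HX (pos X X>0) f')
        (≋⇒≡ (⨾-cong (▹-≋ _ (star-pres Y)) (p-cong (sym (star-pres Y)) ∙ ≋-sym (p-pres _))
          ∙ ≡⇒≋ (sym (resp-⨾ H _ _))
          ∙ hom-cong H (CSystemStr.s-p A.LC X X>0 f)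
          ∙ ≡⇒≋ (resp-id H)
          ∙ ≋-sym (CSystemStr.s-p B.LC HX (pos X X>0) (hom H f))))
        (≋⇒≡ (⨾-cong (▹-≋ _ (star-pres Y))
                     (v-cong (sym (star-pres Y)) ∙ ≋-sym (v-pres _ (A.star-l X X>0 (Category._⨾_ (op TA.T) f (A.p X)))))
          ∙ ≡⇒≋ (trans (sym (resp-⨾ H _ _)) (trans (cong (hom H) (A.s-v X X>0 f)) (resp-⨾ H _ _)))
          ∙ ⨾-cong refl (v-pres X X>0)
          ∙ ≡⇒≋ (sym (B.s-v HX (pos X X>0) (hom H f))))))
        where
        HX = obj H X
        f' = hom H f ⨾ B.p HX

    LC-isHom : IsCSystemHom A.LC B.LC (opF functor)
    LC-isHom = record
      { l-pres = l-pres ; pt-pres = obj-L 0 ; ft-pres = ft-pres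
      ; p-pres = p-pres ; q-pres = q-pres ; s-pres = s-pres }

  module CLMor {ℓ} {A B : LBijCSystem ℓ} (G : CSystemMor A B) where
    private
      module SA = LBijCSystem A
      module SB = LBijCSystem B
      module CA = CSystemStr SA.cs
      module CB = CSystemStr SB.cs
      module A = CLStr ext SA.cs SA.l-bij
      module B = CLStr ext SB.cs SB.l-bij
      H : Functor SA.CC SB.CC
      H = CSystemMor.functor G
      open IsCSystemHom (CSystemMor.isHom G)
      open Category SB.CC
      open HomEqReasoning SB.CC
      open CSystemProperties SB.cs

      obj-l⁻¹ : ∀ n → obj H (A.l⁻¹ n) ≡ B.l⁻¹ n
      obj-l⁻¹ n = proj₁ SB.l-bij (trans (l-pres _) (trans (A.l-l⁻¹ n) (sym (B.l-l⁻¹ n))))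

      final-≋ : ∀ {Z} → IsFinal SB.CC Z → ∀ {X X' Z'} → X ≡ X' → Z ≡ Z' →
                (f : Hom X Z) (g : Hom X' Z') → SB.CC [ f ≋ g ]
      final-≋ t refl refl f g = ≡⇒≋ (final-unique t f g)

      pₙ-pres : ∀ n → SB.CC [ hom H (A.pₙ n) ≋ B.pₙ n ]
      pₙ-pres n = hom-cong H (HomEqReasoning.▹-≋ _ _ (A.ft-suc n)) ∙ p-pres _
        ∙ p-cong (obj-l⁻¹ (suc n)) ∙ ≋-sym (▹-≋ _ (B.ft-suc n))

      qₙ-pres : ∀ n → SB.CC [ hom H (A.qₙ n) ≋ B.qₙ n ]
      qₙ-pres n = hom-cong H (HomEqReasoning.◃-≋ _ (A.star-suc n _) _) ∙ q-pres _ _ _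
        ∙ q-cong (obj-l⁻¹ 1) (≋-sym (final-≋ (subst (IsFinal SB.CC) (sym (B.ft-suc 0)) B.final₀)
            (sym (obj-l⁻¹ n)) (cong CB.ft (sym (obj-l⁻¹ 1))) _ _))
        ∙ ≋-sym (◃-≋ (B.star-suc n _) _)

      π-view-pres : ∀ n → (∀ i → SB.CC [ hom H (A.π n i) ≋ B.π n i ]) → ∀ {i} (w : View i) →
                    SB.CC [ hom H (A.π-view n (A.π n) w) ≋ B.π-view n (B.π n) w ]
      π-view-pres n _  ‵fromℕ            = qₙ-pres n
      π-view-pres n ih (‵inj₁ {i = i} _) = ≡⇒≋ (resp-⨾ H _ _) ∙ ⨾-cong (pₙ-pres n) (ih i)

      π-pres : ∀ n i → SB.CC [ hom H (A.π n i) ≋ B.π n i ]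
      π-pres (suc zero)    i = ≡⇒≋ (resp-id H) ∙ id-cong (obj-l⁻¹ 1)
      π-pres (suc (suc n)) i = π-view-pres (suc n) (π-pres (suc n)) (view i)

      ⟪⟫-pres : ∀ {m n} (f : Fin m → Fin n) → SB.CC [ hom H A.⟪ f ⟫ ≋ B.⟪ f ⟫ ]
      ⟪⟫-pres {m} {n} f = ≋-sym (◃-≋ (obj-l⁻¹ n) _ ∙ ▹-≋ _ (obj-l⁻¹ m))
        ∙ ≡⇒≋ (B.π-unique m {w = obj-l⁻¹ n ◃ (hom H A.⟪ f ⟫ ▹ obj-l⁻¹ m)} (λ i → ≋⇒≡
            (⨾-cong (◃-≋ (obj-l⁻¹ n) _ ∙ ▹-≋ _ (obj-l⁻¹ m)) (≋-sym (π-pres m i))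
            ∙ ≡⇒≋ (trans (sym (resp-⨾ H _ _)) (cong (hom H) (A.⟪⟫-π m f i)))
            ∙ π-pres n (f i)
            ∙ ≡⇒≋ (sym (B.⟪⟫-π m f i)))))

    CL-strict : A.CL-functor ⋙ opF H ≡ B.CL-functor
    CL-strict = Functor-≡ obj-l⁻¹ (λ f → op-≋ SB.CC (⟪⟫-pres f))

  LCU : ∀ ℓ → Functor (LW ℓ) (Csℕ ℓ)
  LCU ℓ = record
    { obj     = λ A → let open LCStr ext (LawvereTheory.str A) in
                      mkSystem (op (LawvereTheory.T A)) LC LC-bij
    ; hom     = λ G → mkSystemMor (opF (LawvereMor.functor G)) (LCMor.LC-isHom G)
    ; resp-id = CSystemMor-≡ refl
    ; resp-⨾  = λ _ _ → CSystemMor-≡ refl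
    }

  CLU : ∀ ℓ → Functor (Csℕ ℓ) (LW ℓ)
  CLU ℓ = record
    { obj     = λ A → let open LBijCSystem A in mkTheory (op CC) (CLStr.CL ext cs l-bij)
    ; hom     = λ G → mkTheoryMor (opF (CSystemMor.functor G)) (CLMor.CL-strict G)
    ; resp-id = LawvereMor-≡ refl
    ; resp-⨾  = λ _ _ → LawvereMor-≡ refl
    }

{-# OPTIONS --safe #-}
module Submission where

-- Both constructions keep the category up to op, and op (op C) is C itself, so
-- only structures have to be compared; on morphisms both composites keep the
-- underlying functor.  Every law of a structure is a proposition (equality proofs
-- are unique, and universal properties determine their data), so structures are
-- compared through their operations: the functor L for a Lawvere theory, and
-- (l, pt, ft, p, q, s) for a C-system.
--
-- LC followed by CL.  Objects agree by construction.  In the C-system LC(L) the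
-- projection π^n_i is L(const i), by induction on n (π-agree): the canonical
-- projection p is L(ii₁), and q(π, L(1)) is L(ii₂), because its defining equation
-- composes it with L(ii₂^{0,1}), the identity of L(1).  The functor built from
-- LC(L) sends f to the morphism with i-th coordinate π_{f(i)}, and by functoriality
-- of L the morphism L(f) has the same coordinates; coordinates determine a morphism
-- (⟪⟫-agree).
--
-- CL followed by LC.  The length function is the same, and l determines ft.  The
-- morphism L_f for f = ii₁ has the same coordinates as p, which gives p (⟪inject₁⟫,
-- p-agree).  The last coordinate v_X, which is L_f for f = ii₂, is
-- q(π_{ft X}, l⁻¹(1)), of which X is the domain by l-bijectivity (v-agree); so the
-- law q-⨾, applied to f : Y → ft X followed by the morphism from ft X to the final
-- object, says q(f,X) ∘ v_X = v_{f^*X}, in diagrammatic order (q-v).  Together with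
-- the law named square, this is the property which defines the operation q of
-- LC(CL(cs)) (q-agree).  The object pt is the only one of length 0, and s is
-- determined by its section property, its compatibility with q and the pull-back
-- property of the squares (CSystemStr-≡).

open import Defs
open import Axiom.Extensionality.Propositional using (implicit-extensionality)
open import Axiom.UniquenessOfIdentityProofs.WithK using (uip)
open import Data.Fin using (Fin; zero; suc; fromℕ; inject₁)
open import Data.Fin.Relation.Unary.Top using (View; view; ‵fromℕ; ‵inj₁; view-fromℕ; view-inject₁)
open import Data.Nat using (zero; suc; pred; _<_; z<s)
open import Data.Nat.Properties using (<-irrelevant)
open import Data.Product using (∃!; _×_; _,_; proj₁; proj₂)
open import Function using (Bijective; const; _∘_)
open import Level using (Level)
open import Relation.Binary.HeterogeneousEquality using (_≅_; refl; ≅-to-≡)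
open import Relation.Binary.PropositionalEquality using (_≡_; refl; sym; trans; cong; cong₂; subst)
open import Relation.Nullary using (Irrelevant)

open Functor

private
  variable
    a b o h : Level

-- Strict equality of morphisms

≋-irr : {C : Category o h} → let open Category C in
        ∀ {X Y X' Y'} {f : Hom X Y} {g : Hom X' Y'} → Irrelevant (C [ f ≋ g ])
≋-irr refl refl = refl

≋-dom : {C : Category o h} → let open Category C in
        ∀ {X Y X' Y'} {f : Hom X Y} {g : Hom X' Y'} → C [ f ≋ g ] → X ≡ X'
≋-dom refl = refl

-- Parallel morphisms into a final object are equal, even when their domains and
-- codomains are only propositionally the same.
final-≋ : {C : Category o h} → let open Category C in
          ∀ {Z Z'} → IsFinal C Z → ∀ {X X'} → X ≡ X' → Z ≡ Z' →
          (f : Hom X Z) (g : Hom X' Z') → C [ f ≋ g ]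
final-≋ {C = C} t refl refl f g = ≡⇒≋ (final-unique t f g)
  where open HomEqReasoning C

-- Irrelevance of laws, and equality of structures

module Irrelevance (ext : FunExt) where

  Π-irr : {A : Set a} {B : A → Set b} → (∀ x → Irrelevant (B x)) → Irrelevant (∀ x → B x)
  Π-irr i f g = ext (λ x → i x (f x) (g x))

  -- The superscript ⁱ marks functions with an implicit argument, and ˢ functions
  -- with an irrelevant one.
  Πⁱ-ext : {A : Set a} {B : A → Set b} {f g : ∀ {x} → B x} →
           (∀ x → f {x} ≡ g {x}) → (λ {x} → f {x}) ≡ (λ {x} → g {x})
  Πⁱ-ext e = implicit-extensionality ext (λ {x} → e x)

  Πⁱ-irr : {A : Set a} {B : A → Set b} → (∀ x → Irrelevant (B x)) → Irrelevant (∀ {x} → B x)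
  Πⁱ-irr i f g = Πⁱ-ext (λ x → i x (f {x}) (g {x}))

  private
    -- A type with its elements identified: functions with an irrelevant argument in
    -- A are functions on Squash A, to which extensionality applies.
    record Squash (A : Set a) : Set a where
      constructor squash
      field .get : A

  Πˢ-ext : {A : Set a} {B : .A → Set b} {f g : .(x : A) → B x} →
             (.(x : A) → f x ≡ g x) → f ≡ g
  Πˢ-ext {B = B} {f} {g} e = cong (λ k .x → k (squash x))
    (ext {B = λ { (squash x) → B x }} {f = λ { (squash x) → f x }} {g = λ { (squash x) → g x }}
         λ { (squash x) → e x })

  Πˢ-irr : {A : Set a} {B : .A → Set b} → (.(x : A) → Irrelevant (B x)) → Irrelevant (.(x : A) → B x)
  Πˢ-irr i f g = Πˢ-ext (λ x → i x (f x) (g x))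

  bijective-irr : {A : Set a} {B : Set b} {f : A → B} → Irrelevant (Bijective _≡_ _≡_ f)
  bijective-irr (i , s) (i' , s') = cong₂ _,_
    (Πⁱ-irr (λ _ → Πⁱ-irr (λ _ → Π-irr (λ _ → uip))) i i')
    (Π-irr (λ y → preimage-irr y) s s')
    where
    -- By injectivity the preimage is unique.
    preimage-irr : ∀ y → Irrelevant _
    preimage-irr y (x , e) (x' , e')
      with refl ← i (trans (e refl) (sym (e' refl))) =
      cong (x ,_) (Πⁱ-irr (λ _ → Π-irr (λ _ → uip)) e e')

  ∃!-irr : {A : Set a} {B : A → Set b} → (∀ x → Irrelevant (B x)) → Irrelevant (∃! _≡_ B)
  ∃!-irr i (x , b , u) (x' , b' , u')
    with refl ← u b' =
    cong (x ,_) (cong₂ _,_ (i x b b') (Πⁱ-irr (λ _ → Π-irr (λ _ → uip)) u u'))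

  module _ {C : Category o h} where
    open Category C

    initial-irr : ∀ {I} → Irrelevant (IsInitial C I)
    initial-irr = Π-irr (λ { X (f , u) (f' , u') → lemma f f' u u' })
      where
      lemma : ∀ {X Y} (f f' : Hom X Y) (u : ∀ g → f ≡ g) (u' : ∀ g → f' ≡ g) → (f , u) ≡ (f' , u')
      lemma f f' u u' with refl ← u f' = cong (f ,_) (Π-irr (λ _ → uip) u u')

    pushout-irr : ∀ {A B₁ B₂ P} {f₁ : Hom A B₁} {f₂ : Hom A B₂} {i₁ : Hom B₁ P} {i₂ : Hom B₂ P} →
                  Irrelevant (IsPushout C f₁ f₂ i₁ i₂)
    pushout-irr record { commute = c ; universal = u } record { commute = c' ; universal = u' }
      with refl ← uip c c'
         | refl ← Πⁱ-irr (λ _ → Π-irr (λ _ → Π-irr (λ _ → Π-irr (λ _ → ∃!-irr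
                    (λ { _ (e₁ , e₂) (e₁' , e₂') → cong₂ _,_ (uip e₁ e₁') (uip e₂ e₂') })))))
                    (λ {E} → u {E}) (λ {E} → u' {E}) = refl

  final-irr : {C : Category o h} → ∀ {Z} → Irrelevant (IsFinal C Z)
  final-irr {C = C} = initial-irr {C = op C}

  -- A Lawvere theory structure is determined by its functor.
  LawvereStr-≡ : {T : Category o h} {S S' : LawvereStr T} →
                 LawvereStr.L S ≡ LawvereStr.L S' → S ≡ S'
  LawvereStr-≡ {T = T} {record { L = L ; obj-bij = b ; initial = i ; pushout = p }}
               {record { L = L ; obj-bij = b' ; initial = i' ; pushout = p' }} refl
    with refl ← bijective-irr b b'
    with refl ← initial-irr {C = T} i i'
    with refl ← ext {f = p} {g = p'} (λ m → ext (λ n → pushout-irr (p m n) (p' m n))) = refl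

  module _ {C : Category o h} where
    open Category C
    open HomEqReasoning C

    -- A C-system structure is determined by l, ft, p and q: pt is the only object of
    -- length 0, f^*(X) is the domain of q(f,X), and two choices of s_f agree because
    -- they have the same composites with the projections of a pull-back square.
    CSystemStr-≡ : (cs cs' : CSystemStr C) → let
                     module S = CSystemStr cs
                     module S' = CSystemStr cs'
                   in
                   (∀ X → S.l X ≡ S'.l X) →
                   (∀ X → S.ft X ≡ S'.ft X) →
                   (∀ X → C [ S.p X ≋ S'.p X ]) →
                   (∀ X .(X>0 : 0 < S.l X) .(X>0' : 0 < S'.l X) {Y}
                      (f : Hom Y (S.ft X)) (f' : Hom Y (S'.ft X)) → C [ f ≋ f' ] →
                      C [ S.q X X>0 f ≋ S'.q X X>0' f' ]) →
                   cs ≡ cs'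
    CSystemStr-≡
      cs@(record { l = l ; pt = pt ; ft = ft ; p = p ; star = star ; q = q ; l-pt = a₁ ; l-zero = a₂
             ; l-ft = a₃ ; ft-pt = a₄ ; pt-final = a₅ ; star-l = a₆ ; star-ft = a₇ ; square = a₈
             ; star-id = a₉ ; q-id = a₁₀ ; star-⨾ = a₁₁ ; q-⨾ = a₁₂
             ; s = s ; s-p = a₁₃ ; s-q = a₁₄ ; s-star = a₁₅ })
      record { l = l' ; pt = pt' ; ft = ft' ; p = p' ; star = star' ; q = q' ; l-pt = b₁ ; l-zero = b₂
             ; l-ft = b₃ ; ft-pt = b₄ ; pt-final = b₅ ; star-l = b₆ ; star-ft = b₇ ; square = b₈
             ; star-id = b₉ ; q-id = b₁₀ ; star-⨾ = b₁₁ ; q-⨾ = b₁₂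
             ; s = s' ; s-p = b₁₃ ; s-q = b₁₄ ; s-star = b₁₅ }
      el eft ep eq
      with refl ← ext {f = l} {g = l'} el
      with refl ← ext {f = ft} {g = ft'} eft
      -- pt has length 0 for both structures.
      with refl ← b₂ pt a₁
      with refl ← ext {f = p} {g = p'} (λ X → ≋⇒≡ (ep X))
      with refl ← ext {f = star} {g = star'} (λ X → Πˢ-ext (λ X>0 → Πⁱ-ext (λ Y → ext (λ f →
                    ≋-dom (eq X X>0 X>0 f f refl)))))
      with refl ← ext {f = q} {g = q'} (λ X → Πˢ-ext (λ X>0 → Πⁱ-ext (λ Y → ext (λ f →
                    ≋⇒≡ (eq X X>0 X>0 f f refl)))))
      -- From here on the two structures differ only in s and in proofs.
      with refl ← uip a₁ b₁
      with refl ← Π-irr (λ _ → Π-irr (λ _ → uip)) a₂ b₂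
      with refl ← Π-irr (λ _ → Πˢ-irr (λ _ → uip)) a₃ b₃
      with refl ← uip a₄ b₄
      with refl ← final-irr {C = C} a₅ b₅
      with refl ← Π-irr (λ _ → Πˢ-irr (λ _ → Πⁱ-irr (λ _ → Π-irr (λ _ → <-irrelevant)))) a₆ b₆
      with refl ← Π-irr (λ _ → Πˢ-irr (λ _ → Πⁱ-irr (λ _ → Π-irr (λ _ → uip)))) a₇ b₇
      with refl ← Π-irr (λ _ → Πˢ-irr (λ _ → Πⁱ-irr (λ _ → Π-irr (λ _ → uip)))) a₈ b₈
      with refl ← Π-irr (λ _ → Πˢ-irr (λ _ → uip)) a₉ b₉
      with refl ← Π-irr (λ _ → Πˢ-irr (λ _ → ≋-irr)) a₁₀ b₁₀
      with refl ← Π-irr (λ _ → Πˢ-irr (λ _ → Πⁱ-irr (λ _ → Πⁱ-irr (λ _ →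
                    Π-irr (λ _ → Π-irr (λ _ → uip)))))) a₁₁ b₁₁
      with refl ← Π-irr (λ _ → Πˢ-irr (λ _ → Πⁱ-irr (λ _ → Πⁱ-irr (λ _ →
                    Π-irr (λ _ → Π-irr (λ _ → ≋-irr)))))) a₁₂ b₁₂
      with refl ← ext {f = s} {g = s'} (λ X → Πˢ-ext (λ X>0 → Πⁱ-ext (λ Y → ext (λ f →
                    CSystemProperties.pull-unique cs X X>0 (f ⨾ p X)
                      (≋⇒≡ (a₁₃ X X>0 f ∙ ≋-sym (b₁₃ X X>0 f)))
                      (trans (a₁₄ X X>0 f) (sym (b₁₄ X X>0 f)))))))
      with refl ← Π-irr (λ _ → Πˢ-irr (λ _ → Πⁱ-irr (λ _ → Π-irr (λ _ → ≋-irr)))) a₁₃ b₁₃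
      with refl ← Π-irr (λ _ → Πˢ-irr (λ _ → Πⁱ-irr (λ _ → Π-irr (λ _ → uip)))) a₁₄ b₁₄
      with refl ← Π-irr (λ _ → Πˢ-irr (λ _ → Πⁱ-irr (λ _ → Π-irr (λ _ →
                    Πⁱ-irr (λ _ → Π-irr (λ _ → ≋-irr)))))) a₁₅ b₁₅
      = refl

-- Projections in the Lawvere theory of a C-system

module CLProjections (ext : FunExt) {CC : Category o h} (cs : CSystemStr CC)
                     (l-bij : Bijective _≡_ _≡_ (CSystemStr.l cs)) where
  open Category CC
  open CLStr ext cs l-bij
  open CSystemStr cs
  open CSystemProperties cs
  open HomEqReasoning CC

  -- Unlike the recursion which defines π, this and π-fromℕ below cover the
  -- projections of l⁻¹(1), where n = 0.
  π-inject₁ : ∀ n (i : Fin n) → π (suc n) (inject₁ i) ≡ pₙ n ⨾ π n i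
  π-inject₁ (suc n) i = cong (π-view (suc n) (π (suc n))) (view-inject₁ i)

  -- The law q-id, since f is the identity of the final object ft(l⁻¹(1)).
  π₁≋qₙ : ∀ (f : Hom (l⁻¹ 0) (ft (l⁻¹ 1))) → CC [ id {l⁻¹ 1} ≋ q (l⁻¹ 1) (suc>0 0) f ]
  π₁≋qₙ f = ≋-sym (q-id (l⁻¹ 1) (suc>0 0)) ∙ q-cong refl
    (final-≋ (subst (IsFinal CC) (sym (ft-suc 0)) final₀) (ft-suc 0) refl _ _)

  π-fromℕ : ∀ n → π (suc n) (fromℕ n) ≡ qₙ n
  π-fromℕ zero    = ≋⇒≡ (π₁≋qₙ _ ∙ ≋-sym (◃-≋ (star-suc 0 _) _))
  π-fromℕ (suc n) = cong (π-view (suc n) (π (suc n))) (view-fromℕ (suc n))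

  -- L_{ii₁^{n,1}} is the canonical projection.
  ⟪inject₁⟫ : ∀ n → ⟪ inject₁ {n} ⟫ ≡ pₙ n
  ⟪inject₁⟫ n = π-unique n (λ i → trans (⟪⟫-π n inject₁ i) (π-inject₁ n i))

-- Recovering a Lawvere theory from its C-system

-- The round trip of a Lawvere theory structure L, along LC and then CL.  The module S
-- is LC(L), and R is the Lawvere theory structure CL(LC(L)).
module CL∘LC (ext : FunExt) {T : Category o h} (S : LawvereStr T) where
  open LawvereStr S using (L)
  open Category (op T)
  open HomEqReasoning (op T)
  private
    module S = LCStr ext {T = T} S
    module R = CLStr ext {CC = op T} (LCStr.LC ext {T = T} S) (LCStr.LC-bij ext {T = T} S)

  pₙ-cong : ∀ {k k'} → k ≡ k' → op T [ S.pₙ k ≋ S.pₙ k' ]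
  pₙ-cong refl = refl

  vₙ-cong : ∀ {k k'} .{k>0 : 0 < k} .{k'>0 : 0 < k'} → k ≡ k' →
            op T [ S.vₙ k k>0 ≋ S.vₙ k' k'>0 ]
  vₙ-cong refl = refl

  p-L : ∀ n → op T [ S.p (obj L n) ≋ S.pₙ n ]
  p-L n = ◃-≋ (S.Ll (obj L n)) _ ∙ pₙ-cong (S.lL n)

  v-L : ∀ n .(n>0 : 0 < n) .(Ln>0 : 0 < S.l (obj L n)) → op T [ S.v (obj L n) Ln>0 ≋ S.vₙ n n>0 ]
  v-L n _ _ = ◃-≋ (S.Ll (obj L n)) _ ∙ vₙ-cong (S.lL n)

  -- There is only one function from stn(1) to itself.
  ⟪⟫-id : (f : Fin 1 → Fin 1) → S.⟪ f ⟫ ≡ id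
  ⟪⟫-id f = trans (cong S.⟪_⟫ (ext (λ i → Fin1 (f i) i))) (resp-id L)
    where
    Fin1 : ∀ (i j : Fin 1) → i ≡ j
    Fin1 zero zero = refl

  pₙ-agree : ∀ n → R.pₙ n ≡ S.⟪ inject₁ {n} ⟫
  pₙ-agree n = ≋⇒≡ (▹-≋ _ (R.ft-suc n) ∙ p-L (suc n))

  qₙ-agree : ∀ n → R.qₙ n ≡ S.⟪ const (fromℕ n) ⟫
  qₙ-agree n = ≋⇒≡ (◃-≋ (R.star-suc n t) _
    -- Composing with L(ii₂^{0,1}), an identity, brings in the defining equation of q.
    ∙ ≡⇒≋ (sym (identityʳ _))
    ∙ ⨾-cong refl (≡⇒≋ (sym (⟪⟫-id (const zero))) ∙ ≋-sym (v-L 1 z<s (R.suc>0 0)))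
    ∙ ≡⇒≋ (S.q-v (obj L 1) (R.suc>0 0) t)
    ∙ v-L (suc (S.l (obj L n))) z<s (S.star-l (obj L 1) (R.suc>0 0) t)
    ∙ vₙ-cong {k>0 = z<s} {z<s} (cong suc (S.lL n)))
    where
    t : Hom (obj L n) (S.ft (obj L 1))
    t = R.π! (obj L n) ▹ sym (R.ft-suc 0)

  -- π^n_i is L of the function stn(1) → stn(n) with value i.
  π-agree : ∀ n i → R.π n i ≡ S.⟪ const i ⟫
  π-agree (suc zero)    zero = sym (⟪⟫-id (const zero))
  π-agree (suc (suc n)) i    = go (π-agree (suc n)) (view i)
    where
    go : (∀ i → R.π (suc n) i ≡ S.⟪ const i ⟫) →
         ∀ {i} (w : View i) → R.π-view (suc n) (R.π (suc n)) w ≡ S.⟪ const i ⟫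
    go _  ‵fromℕ            = qₙ-agree (suc n)
    go ih (‵inj₁ {i = i} _) = trans (cong₂ _⨾_ (pₙ-agree (suc n)) (ih i))
      (sym (resp-⨾ L (const i) inject₁))

  ⟪⟫-agree : ∀ {m n} (f : Fin m → Fin n) → R.⟪ f ⟫ ≡ S.⟪ f ⟫
  ⟪⟫-agree {m} {n} f = R.π-unique m (λ i → trans (R.⟪⟫-π m f i)
    (trans (π-agree n (f i)) (trans (resp-⨾ L (const i) f)
      (cong (S.⟪ f ⟫ ⨾_) (sym (π-agree m i))))))

  open Irrelevance ext
  open Extensional ext

  CL∘LC≡id : CLStr.CL ext {CC = op T} (LCStr.LC ext {T = T} S) (LCStr.LC-bij ext {T = T} S) ≡ S
  CL∘LC≡id = LawvereStr-≡ (Functor-≡ (λ _ → refl) (λ f → HomEqReasoning.≡⇒≋ T (⟪⟫-agree f)))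

-- Recovering a C-system from its Lawvere theory

-- The round trip of a C-system structure cs, along CL and then LC.  The module S
-- is CL(cs), and R is the C-system LC(CL(cs)).
module LC∘CL (ext : FunExt) {CC : Category o h} (cs : CSystemStr CC)
             (l-bij : Bijective _≡_ _≡_ (CSystemStr.l cs)) where
  open Category CC
  open HomEqReasoning CC
  open CSystemStr cs
  open CSystemProperties cs
  open CLProjections ext cs l-bij
  private
    module S = CLStr ext {CC = CC} cs l-bij
    module R = LCStr ext {T = op CC} (CLStr.CL ext {CC = CC} cs l-bij)

  ft-agree : ∀ X → R.ft X ≡ ft X
  ft-agree X = proj₁ l-bij (trans (S.l-l⁻¹ _) (pred-l (l X) refl))
    where
    pred-l : ∀ n → l X ≡ n → pred (l X) ≡ l (ft X)
    pred-l zero    e = trans (trans (cong pred e) (trans (sym l-pt) (cong l (sym ft-pt))))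
                             (cong (l ∘ ft) (sym (l-zero X e)))
    pred-l (suc n) e = sym (l-ft X (subst (0 <_) (sym e) z<s))

  -- Off length 0 this is ⟪inject₁⟫, with X written as l⁻¹(l(X)).
  p-agree : ∀ X → CC [ R.p X ≋ p X ]
  p-agree X = ◃-≋ (R.Ll X) _ ∙ pₙ-agree (l X) ∙ p-cong (S.l⁻¹-l X)
    where
    pₙ-agree : ∀ n → CC [ R.pₙ n ≋ p (S.l⁻¹ n) ]
    -- p_pt is an endomorphism of the final object, hence the identity.
    pₙ-agree zero    = final-≋ S.final₀ refl
      (trans (sym S.l⁻¹0) (trans (sym ft-pt) (cong ft S.l⁻¹0))) _ _
    pₙ-agree (suc n) = ≡⇒≋ (⟪inject₁⟫ n) ∙ ▹-≋ _ (S.ft-suc n)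

  -- The last coordinate of X is q(g, l⁻¹(1)) for the morphism g from ft(X) to the
  -- final object ft(l⁻¹(1)).  The domain of g is a separate variable because it is
  -- ft(X) only up to a propositional equality in the application to f^*(X).
  v-agree : ∀ X .(X>0 : 0 < l X) {Y} (g : Hom Y (ft (S.l⁻¹ 1))) → Y ≡ ft X →
            CC [ R.v X X>0 ≋ q (S.l⁻¹ 1) (S.suc>0 0) g ]
  v-agree X X>0 g eY = ◃-≋ (R.Ll X) _ ∙ vₙ-agree (l X) X>0
      (trans eY (sym (ft-agree X)))
    where
    vₙ-agree : ∀ n .(n>0 : 0 < n) → _ ≡ S.l⁻¹ (pred n) →
               CC [ R.vₙ n n>0 ≋ q (S.l⁻¹ 1) (S.suc>0 0) g ]
    vₙ-agree (suc n) _ e = ≡⇒≋ (π-fromℕ n) ∙ ◃-≋ (S.star-suc n _) _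
      ∙ q-cong refl (final-≋ (subst (IsFinal CC) (sym (S.ft-suc 0)) S.final₀) (sym e) refl _ _)

  -- Both sides have length l(Y) + 1.
  star-agree : ∀ X .(X>0 : 0 < l X) {Y} (f : Hom Y (ft X)) → star X X>0 f ≡ S.l⁻¹ (suc (l Y))
  star-agree X X>0 f = proj₁ l-bij (trans
      (suc-eq (star-l X X>0 f) (trans (sym (l-ft _ (star-l X X>0 f))) (cong l (star-ft X X>0 f))))
      (sym (S.l-l⁻¹ _)))
    where
    suc-eq : ∀ {k n} → .(0 < k) → pred k ≡ n → k ≡ suc n
    suc-eq {suc k} _ refl = refl

  -- The second equation defining the operation q of LC(CL(cs)), for the original q.
  -- It is the law q-⨾ for f followed by the morphism t to the final object.
  q-v : ∀ X .(X>0 : 0 < l X) {Y} (f : Hom Y (ft X)) →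
        q X X>0 f ⨾ R.v X X>0 ≡ R.v (star X X>0 f) (star-l X X>0 f)
  q-v X X>0 {Y} f = ≋⇒≡ (⨾-cong (q-cong X≡I* (≋-sym (▹-≋ f _))) vX
      ∙ ≋-sym (q-⨾ I (S.suc>0 0) f t)
      ∙ ≋-sym (v-agree (star X X>0 f) (star-l X X>0 f) (f ⨾ t) (sym (star-ft X X>0 f))))
    where
    I = S.l⁻¹ 1
    t : Hom (ft X) (ft I)
    t = S.π! (ft X) ▹ sym (S.ft-suc 0)
    vX : CC [ R.v X X>0 ≋ q I (S.suc>0 0) t ]
    vX = v-agree X X>0 t refl
    -- The domains of two equal morphisms.
    X≡I* : X ≡ star I (S.suc>0 0) t
    X≡I* = ≋-dom vX

  v-cong : ∀ {X X'} .{X>0 : 0 < l X} .{X'>0 : 0 < l X'} → X ≡ X' → CC [ R.v X X>0 ≋ R.v X' X'>0 ]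
  v-cong refl = refl

  q-agree : ∀ X .(X>0 : 0 < l X) .(X>0' : 0 < l X) {Y}
            (f : Hom Y (R.ft X)) (f' : Hom Y (ft X)) → CC [ f ≋ f' ] →
            CC [ R.q X X>0 f ≋ q X X>0' f' ]
  q-agree X X>0 _ {Y} f f' f≋f' = ≡⇒≋ (R.pair-unique X X>0
      (≋⇒≡ (≡⇒≋ (R.square X X>0 f)
        ∙ ⨾-cong (▹-≋ _ (R.star-ft X X>0 f) ∙ p-agree _ ∙ p-cong (sym e) ∙ ≋-sym (▹-≋ _ (star-ft X X>0 f')))
                 f≋f'
        ∙ ≡⇒≋ (sym (square X X>0 f'))
        ∙ ⨾-cong (≋-sym (◃-≋ e _)) (≋-sym (p-agree X))))
      (≋⇒≡ (≡⇒≋ (R.q-v X X>0 f)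
        ∙ v-cong (sym e)
        ∙ ≡⇒≋ (sym (q-v X X>0 f'))
        ∙ ⨾-cong (≋-sym (◃-≋ e _)) refl)))
    ∙ ◃-≋ e _
    where
    e : star X X>0 f' ≡ S.l⁻¹ (suc (l Y))
    e = star-agree X X>0 f'

  LC∘CL≡id : LCStr.LC ext {T = op CC} (CLStr.CL ext {CC = CC} cs l-bij) ≡ cs
  LC∘CL≡id = Irrelevance.CSystemStr-≡ ext (LCStr.LC ext {T = op CC} (CLStr.CL ext {CC = CC} cs l-bij)) cs
    (λ _ → refl) ft-agree p-agree q-agree

-- The two functors are mutually inverse

module RoundTrips (ext : FunExt) (ℓ : Level) where
  open Irrelevance ext
  open Extensional ext

  -- In this lemma and in LCU-obj the given object and its components are variables,
  -- and the equation between them is matched with refl.  Unification then happens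
  -- here once, before the large structures LC(L) and CL(cs) take their place.
  CLU-obj : ∀ {T S cs b} B → B ≡ mkSystem (op T) cs b →
            CLStr.CL ext {CC = op T} cs b ≡ S → obj (CLU ℓ) B ≡ mkTheory T S
  CLU-obj B refl refl = refl

  mkSystem-≡ : {C : Category ℓ ℓ} {cs cs' : CSystemStr C}
               {b : Bijective _≡_ _≡_ (CSystemStr.l cs)}
               {b' : Bijective _≡_ _≡_ (CSystemStr.l cs')} →
               cs ≡ cs' → mkSystem C cs b ≡ mkSystem C cs' b'
  mkSystem-≡ {C} {cs} {b = b} {b'} refl =
    cong (mkSystem C cs) (bijective-irr {f = CSystemStr.l cs} b b')

  LCU-obj : ∀ {CC cs b} A {S} → A ≡ mkTheory (op CC) S →
            LCStr.LC ext {T = op CC} S ≡ cs → obj (LCU ℓ) A ≡ mkSystem CC cs b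
  LCU-obj A refl refl = mkSystem-≡ refl

  LCU-CLU-obj : ∀ A → obj (LCU ℓ ⋙ CLU ℓ) A ≡ A
  LCU-CLU-obj (mkTheory T S) =
    let CL∘LC≡id = CL∘LC.CL∘LC≡id {ℓ} {ℓ} ext {T} S
    in CLU-obj {T} {S} {LCStr.LC ext {T = T} S} {LCStr.LC-bij ext {T = T} S}
               (obj (LCU ℓ) (mkTheory T S)) refl CL∘LC≡id

  CLU-LCU-obj : ∀ A → obj (CLU ℓ ⋙ LCU ℓ) A ≡ A
  CLU-LCU-obj (mkSystem CC cs b) =
    let LC∘CL≡id = LC∘CL.LC∘CL≡id {ℓ} {ℓ} ext {CC} cs b
    in LCU-obj {CC} {cs} {b} (obj (CLU ℓ) (mkSystem CC cs b))
               {CLStr.CL ext {CC = CC} cs b} refl LC∘CL≡id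

  -- Morphisms between equal objects are equal as soon as their functors are.  The
  -- functors are compared heterogeneously: in the applications below the equal
  -- objects have the same underlying category by computation.
  LawvereMor-≋ : ∀ {A A' B B'} → A ≡ A' → B ≡ B' →
                 (G : LawvereMor A B) (G' : LawvereMor A' B') →
                 LawvereMor.functor G ≅ LawvereMor.functor G' → LW ℓ [ G ≋ G' ]
  LawvereMor-≋ refl refl G G' e = HomEqReasoning.≡⇒≋ (LW ℓ) (LawvereMor-≡ (≅-to-≡ e))

  CSystemMor-≋ : ∀ {A A' B B'} → A ≡ A' → B ≡ B' →
                 (G : CSystemMor A B) (G' : CSystemMor A' B') →
                 CSystemMor.functor G ≅ CSystemMor.functor G' → Csℕ ℓ [ G ≋ G' ]
  CSystemMor-≋ refl refl G G' e = HomEqReasoning.≡⇒≋ (Csℕ ℓ) (CSystemMor-≡ (≅-to-≡ e))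

  LW-functor-≡-id :
    {H : Functor (LW ℓ) (LW ℓ)} → (∀ A → obj H A ≡ A) →
    (∀ {A B} (G : LawvereMor A B) → LawvereMor.functor (hom H G) ≅ LawvereMor.functor G) →
    H ≡ idF {C = LW ℓ}
  LW-functor-≡-id {H} eo eh =
    Functor-≡ eo (λ {A} {B} G → LawvereMor-≋ (eo A) (eo B) (hom H G) G (eh G))

  Csℕ-functor-≡-id :
    {H : Functor (Csℕ ℓ) (Csℕ ℓ)} → (∀ A → obj H A ≡ A) →
    (∀ {A B} (G : CSystemMor A B) → CSystemMor.functor (hom H G) ≅ CSystemMor.functor G) →
    H ≡ idF {C = Csℕ ℓ}
  Csℕ-functor-≡-id {H} eo eh =
    Functor-≡ eo (λ {A} {B} G → CSystemMor-≋ (eo A) (eo B) (hom H G) G (eh G))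

theorem0p6p1 : (ext : FunExt) (ℓ : Level) →
    let open Extensional ext in
    (LCU ℓ ⋙ CLU ℓ ≡ idF {C = LW ℓ}) × (CLU ℓ ⋙ LCU ℓ ≡ idF {C = Csℕ ℓ})
theorem0p6p1 ext ℓ =
    LW-functor-≡-id LCU-CLU-obj (λ _ → refl)
  , Csℕ-functor-≡-id CLU-LCU-obj (λ _ → refl)
  where open RoundTrips ext ℓ
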